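{- For every integer $n \ge 3$, $|\zeta(n) - r(n)| < 1.985$, where, with $N := \lfloor \log_2 \log_5 n \rfloor + 1$, \[ r(n) := \left(\sum_{j=1}^N \frac{1}{2^{j-1}} n^{\frac{1}{2^j}}\right) - \frac{2^{N-1} - 1}{2^{N-1}}. \]
   Context: A reachable pair of a digraph is an ordered pair $(\alpha,\beta)$ of (not necessarily distinct) vertices with a directed path (possibly of length $0$) from $\alpha$ to $\beta$; the weight of a digraph is its number of reachable pairs. $W(n)$ is the set of weights of digraphs on $n$ vertices, and $b(n)$ is the largest integer such that every integer $k$ with $n\le k\le b(n)$ lies in $W(n)$. Define $\ell(z) := b(z)-z+3$. For an integer $n\ge 3$, $\zeta(n)$ is the unique positive integer such that $\ell(\zeta(n)) \le n < \ell(\zeta(n)+1)$. -}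

module Defs where

open import Data.Nat as ℕ using (ℕ; zero; suc; _≤_; _<_; _∸_)
open import Data.Fin using (Fin; zero; suc; toℕ)
open import Data.Bool using (Bool; true; false)
open import Data.Product using (Σ; ∃; ∃-syntax; _×_; _,_)
open import Data.Integer using (+_)
open import Data.Rational as ℚ using (ℚ)
open import Relation.Binary.PropositionalEquality using (_≡_)
open import Relation.Nullary using (¬_)
open import Function.Bundles using (_⇔_)
open import Relation.Binary.Construct.Closure.ReflexiveTransitive using (Star)

Digraph : ℕ → Set
Digraph n = Fin n → Fin n → Bool

Arc : ∀ {n} → Digraph n → Fin n → Fin n → Set
Arc D a b = D a b ≡ true

Reachable : ∀ {n} → Digraph n → Fin n → Fin n → Set
Reachable D = Star (Arc D)

countTrue : ∀ {m} → (Fin m → Bool) → ℕ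
countTrue {zero}  f = 0
countTrue {suc m} f with f zero
... | true  = suc (countTrue (λ i → f (suc i)))
... | false = countTrue (λ i → f (suc i))

HasWeight : ∀ {n} → Digraph n → ℕ → Set
HasWeight {n} D k =
  Σ (Fin n → Fin n → Bool) λ χ →
    (∀ a b → (χ a b ≡ true) ⇔ Reachable D a b) × (countAll χ ≡ k)
  where
  countAll : (Fin n → Fin n → Bool) → ℕ
  countAll χ = sumFin (λ a → countTrue (χ a))
    where
    sumFin : ∀ {m} → (Fin m → ℕ) → ℕ
    sumFin {zero}  g = 0
    sumFin {suc m} g = g zero ℕ.+ sumFin (λ i → g (suc i))

InW : ℕ → ℕ → Set
InW n k = ∃[ D ] HasWeight {n} D k

InitialRun : ℕ → ℕ → Set
InitialRun n m = ∀ k → n ≤ k → k ≤ m → InW n k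

IsB : ℕ → ℕ → Set
IsB n m = InitialRun n m × ¬ InitialRun n (suc m)

-- ℓ(z) = b(z) - z + 3 = L   (b(z) ≥ z always, so ∸ is exact)
IsEll : ℕ → ℕ → Set
IsEll z L = ∃[ bz ] (IsB z bz × L ≡ bz ∸ z ℕ.+ 3)

IsZeta : ℕ → ℕ → Set
IsZeta n z = 1 ≤ z × ∃[ L ] ∃[ L' ] (IsEll z L × IsEll (suc z) L' × L ≤ n × n < L')

_^ℚ_ : ℚ → ℕ → ℚ
q ^ℚ zero  = ℚ.1ℚ
q ^ℚ suc k = q ℚ.* (q ^ℚ k)

fromℕ : ℕ → ℚ
fromℕ k = + k ℚ./ 1

-- N(n) = ⌊log₂ log₅ n⌋ + 1 for n ≥ 3, i.e. the number of k ≥ 0 with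
-- 5^(2^k) ≤ n; equivalently the least N with n < 5^(2^N).
-- (For n ∈ {3,4}, log₂ log₅ n ∈ (-1,0), so N = 0.)
IsN : ℕ → ℕ → Set
IsN n N = n < 5 ℕ.^ (2 ℕ.^ N) × (∀ k → k < N → 5 ℕ.^ (2 ℕ.^ k) ≤ n)

pow½ : ℕ → ℚ
pow½ zero    = ℚ.1ℚ
pow½ (suc k) = ℚ.½ ℚ.* pow½ k

-- Σ_{j=1}^N q_j / 2^{j-1}, with q indexed by Fin N (index i ↔ j = i+1)
weightedSum : ∀ {N} → (Fin N → ℚ) → ℚ
weightedSum {zero}  q = ℚ.0ℚ
weightedSum {suc N} q = q zero ℚ.+ ℚ.½ ℚ.* weightedSum (λ i → q (suc i))

-- r(n) evaluated at chosen values q_j in place of n^{1/2^j}: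
-- Σ_{j=1}^N q_j/2^{j-1} - (2^{N-1} - 1)/2^{N-1}
--   = Σ_{j=1}^N q_j/2^{j-1} - 1 + 2/2^N
rWith : (N : ℕ) → (Fin N → ℚ) → ℚ
rWith N q = weightedSum q ℚ.- ℚ.1ℚ ℚ.+ (+ 2 ℚ./ 1) ℚ.* pow½ N

-- r(n) < c : there are rationals q_j > n^{1/2^j} (q_j > 0, q_j^{2^j} > n)
-- such that the expression is still < c.
RLess : ℕ → ℕ → ℚ → Set
RLess n N c = ∃[ q ] ((∀ (i : Fin N) → ℚ.0ℚ ℚ.< q i × fromℕ n ℚ.< (q i ^ℚ (2 ℕ.^ suc (toℕ i))))
                      × rWith N q ℚ.< c)

-- c < r(n) : there are rationals 0 ≤ q_j < n^{1/2^j} (q_j^{2^j} < n)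
-- such that the expression is still > c.
RGreater : ℕ → ℕ → ℚ → Set
RGreater n N c = ∃[ q ] ((∀ (i : Fin N) → ℚ.0ℚ ℚ.≤ q i × (q i ^ℚ (2 ℕ.^ suc (toℕ i))) ℚ.< fromℕ n)
                         × c ℚ.< rWith N q)

c1985 : ℚ
c1985 = + 397 ℚ./ 200

{-# OPTIONS --safe #-}
-- W(n) is the set of sizes of preorders on n points. Adjoining a clique of a points below a
-- preorder on c points shows a(a + c) + W(c) ⊆ W(a + c); with n = a + c these levels an + W(c)
-- overlap as long as ℓ(c) > n, so W(n) contains [n, an + b(c)] for c = ζ(n). Conversely
-- an + b(c) + 1 ∉ W(n): a preorder of that size must have a class of at least a elements, and
-- deleting a of them leaves a preorder on c points of size b(c) + 1. The only exception is
-- n = 8. Hence ℓ(n) = n² - cn + ℓ(c) + c - n.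
--
-- As r(n) = √n + (r(√n) - 1) / 2, this recursion is compared with r one square root at a time:
-- with y = ζ(z), the square root of ℓ(z) is approximately z - y/2 + const. The resulting bounds
-- are z - 1.9 < r(n) < z + 1.8 for z = ζ(n).
module Submission where

open import Defs

-- The class of at least a points exists because 2k is at most n² plus the sum of squares of the
-- class sizes, and classes below a make this too small. For a vertex of a largest class let ρ be
-- its row count plus its column count. Deleting a members leaves k + a² - aρ pairs, which equals
-- b(c) + 1 only when ρ = n + a. A smaller ρ would leave more than c² pairs on c points; for a
-- larger ρ the whole class is deleted instead, and too few pairs remain to be reflexive.
--
-- The recurrence has side conditions relating n, c and b(c). They follow from the bound 3b(n) > 2n²
-- carried through the induction, except for small c, where exact values are used.
--
-- Each square root costs a constant offset, and the error inherited from later roots is halved. The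
-- errors are therefore kept at the fixed points 11/5 below and 4/5 above, whatever N is. The first
-- root is estimated more sharply, which brings the lower error down to 1.9; passing from ζ(n) to
-- ζ(n) + 1 makes the upper one 1.8.

module Weights where

  open import Data.Nat
  open import Data.Nat.Properties
  open import Data.Nat.Tactic.RingSolver using (solve; solve-∀)
  open import Data.Nat.Induction using (<-rec)
  open import Data.Fin using (Fin; zero; suc; punchIn)
  open import Data.Bool using (Bool; true; false; _∧_; not)
  open import Data.Product using (∃; _×_; _,_; proj₁; proj₂)
  open import Data.Sum using (_⊎_; inj₁; inj₂)
  open import Data.List using ([]; _∷_)
  open import Data.Empty using (⊥; ⊥-elim)
  open import Relation.Nullary using (¬_; Dec; yes; no)
  open import Relation.Nullary.Decidable using (from-yes)
  open import Relation.Binary.Definitions using (tri<; tri≈; tri>)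
  open import Relation.Binary.PropositionalEquality
    using (_≡_; _≢_; refl; sym; trans; cong; cong₂; subst; subst₂; module ≡-Reasoning)
  open import Relation.Binary.Construct.Closure.ReflexiveTransitive using (ε; _◅_; _◅◅_)
  open import Function.Bundles using (Equivalence; mk⇔)
  open import Algebra.Properties.Semiring.Sum +-*-semiring
    using (sum; ∑-comm; ∑-distrib-+; sum-remove; sum-cong-≗; *-distribˡ-sum)

  -- Certificate form of linear arithmetic: s is the slack, and no subtraction occurs.
  linear : ∀ {a b} S T s → S ≤ T → a + T + s ≡ b + S → a ≤ b
  linear {a} {b} S T s S≤T e = +-cancelʳ-≤ S a b (begin
    a + S      ≤⟨ +-monoʳ-≤ a S≤T ⟩
    a + T      ≤⟨ m≤m+n (a + T) s ⟩
    a + T + s  ≡⟨ e ⟩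
    b + S      ∎)
    where open ≤-Reasoning

  -- Finite sums and the weight of a digraph

  ⟦_⟧ : Bool → ℕ
  ⟦ true ⟧ = 1
  ⟦ false ⟧ = 0

  sum-mono-≤ : ∀ {n} {f g : Fin n → ℕ} → (∀ i → f i ≤ g i) → sum f ≤ sum g
  sum-mono-≤ {zero} h = z≤n
  sum-mono-≤ {suc n} h = +-mono-≤ (h zero) (sum-mono-≤ (λ i → h (suc i)))

  sum-const : ∀ n k → sum {n} (λ _ → k) ≡ n * k
  sum-const zero k = refl
  sum-const (suc n) k = cong (k +_) (sum-const n k)

  countTrue≡sum : ∀ {m} (f : Fin m → Bool) → countTrue f ≡ sum (λ i → ⟦ f i ⟧)
  countTrue≡sum {zero} f = refl
  countTrue≡sum {suc m} f with f zero
  ... | true = cong suc (countTrue≡sum (λ i → f (suc i)))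
  ... | false = countTrue≡sum (λ i → f (suc i))

  -- The summation inside HasWeight is local to a where block; the two underscores below are
  -- solved by unification to it.
  mutual
    total : ∀ {n} (D : Digraph n) (k : ℕ) (χ : Digraph n) → ℕ
    total = _

    total≡ : ∀ {n} (D : Digraph n) k (w : HasWeight D k) → total D k (proj₁ w) ≡ k
    total≡ D k (χ , _ , e) = e

  mutual
    rowSum : ∀ {p} (D : Digraph p) (k : ℕ) (χ : Digraph p) {m} → (Fin m → ℕ) → ℕ
    rowSum = _

    total-suc : ∀ {n} (D : Digraph (suc n)) k χ →
      total D k χ ≡ countTrue (χ zero) + rowSum D k χ (λ i → countTrue (χ (suc i)))
    -- With all arguments abstracted to variables, the constraint on `rowSum` is a pattern
    -- unification problem and has a unique solution.
    total-suc {n} D k χ with (λ i → countTrue (χ (suc i))) | countTrue (χ zero)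
    ... | g | c with suc n | D | χ
    ... | _ | _ | _ = refl

  rowSum≡sum : ∀ {p} (D : Digraph p) k χ {m} (g : Fin m → ℕ) → rowSum D k χ g ≡ sum g
  rowSum≡sum D k χ {zero} g = refl
  rowSum≡sum D k χ {suc m} g = cong (g zero +_) (rowSum≡sum D k χ (λ i → g (suc i)))

  size : ∀ {n} → Digraph n → ℕ
  size χ = sum (λ a → sum (λ b → ⟦ χ a b ⟧))

  total≡size : ∀ {n} (D : Digraph n) k χ → total D k χ ≡ size χ
  total≡size D k χ =
    trans (rowSum≡sum D k χ (λ a → countTrue (χ a))) (sum-cong-≗ (λ a → countTrue≡sum (χ a)))

  -- Preorders and the adjunction of cliques

  record Preorder {n} (χ : Digraph n) : Set where
    field
      reflx : ∀ a → χ a a ≡ true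
      tran : ∀ {a b c} → χ a b ≡ true → χ b c ≡ true → χ a c ≡ true
  open Preorder

  fromPreorder : ∀ {n} {χ : Digraph n} → Preorder χ → InW n (size χ)
  fromPreorder {n} {χ} P =
    χ , χ , (λ a b → mk⇔ (λ e → e ◅ ε) path) , total≡size χ (size χ) χ
    where
    path : ∀ {a b} → Reachable χ a b → χ a b ≡ true
    path ε = reflx P _
    path (e ◅ p) = tran P e (path p)

  toPreorder : ∀ {n k} → InW n k → ∃ λ (χ : Digraph n) → Preorder χ × size χ ≡ k
  toPreorder {n} {k} (D , w@(χ , h , _)) =
    χ , record { reflx = λ a → from (h a a) ε
               ; tran = λ p q → from (h _ _) (to (h _ _) p ◅◅ to (h _ _) q) }
    , trans (sym (total≡size D k χ)) (total≡ D k w)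
    where
    open Equivalence

  extend : ∀ {n} → (Fin n → Bool) → (Fin n → Bool) → Digraph n → Digraph (suc n)
  extend r c χ zero zero = true
  extend r c χ zero (suc j) = r j
  extend r c χ (suc i) zero = c i
  extend r c χ (suc i) (suc j) = χ i j

  size-extend : ∀ {n} (r c : Fin n → Bool) χ →
    size (extend r c χ) ≡ suc (sum (λ j → ⟦ r j ⟧)) + (sum (λ i → ⟦ c i ⟧) + size χ)
  size-extend r c χ = cong (suc (sum (λ j → ⟦ r j ⟧)) +_)
    (∑-distrib-+ (λ i → ⟦ c i ⟧) (λ i → sum (λ j → ⟦ χ i j ⟧)))

  false≢true : ∀ {A : Set} → false ≡ true → A
  false≢true ()

  isolate : ∀ {n k} → InW n k → InW (suc n) (suc k)
  isolate {n} w with toPreorder w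
  ... | χ , P , refl = subst (InW (suc n)) eq (fromPreorder Q)
    where
    none : Fin n → Bool
    none _ = false
    Q : Preorder (extend none none χ)
    reflx Q zero = refl
    reflx Q (suc a) = reflx P a
    tran Q {zero} {zero} {zero} p q = refl
    tran Q {suc a} {suc b} {suc c} p q = tran P p q
    sum0 : sum (λ i → ⟦ none i ⟧) ≡ 0
    sum0 = trans (sum-const n 0) (*-zeroʳ n)
    eq : size (extend none none χ) ≡ suc (size χ)
    eq = trans (size-extend none none χ) (cong₂ (λ x y → suc x + (y + size χ)) sum0 sum0)

  -- The clique grows by duplicating its vertex `zero`, whose twin copies row and column; the two
  -- apex counts are the invariant that determines how many pairs the twin adds.
  record Cone (a c w : ℕ) : Set where
    field
      rel : Digraph (suc (a + c))
      preorder : Preorder rel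
      apex-row : sum (λ j → ⟦ rel zero j ⟧) ≡ suc (a + c)
      apex-column : sum (λ i → ⟦ rel i zero ⟧) ≡ suc a
      size-cone : size rel ≡ suc a * (suc a + c) + w

  cone : ∀ {c w} a → InW c w → Cone a c w
  cone {c} zero i with toPreorder i
  ... | χ , P , refl = record
    { rel = extend every none χ ; preorder = Q
    ; apex-row = cong suc row ; apex-column = cong suc col
    ; size-cone = trans (size-extend every none χ)
        (trans (cong₂ (λ x y → suc x + (y + size χ)) row col)
               (cong (_+ size χ) (sym (*-identityˡ (suc c))))) }
    where
    every none : Fin c → Bool
    every _ = true
    none _ = false
    row : sum (λ i → ⟦ every i ⟧) ≡ c
    row = trans (sum-const c 1) (*-identityʳ c)
    col : sum (λ i → ⟦ none i ⟧) ≡ 0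
    col = trans (sum-const c 0) (*-zeroʳ c)
    Q : Preorder (extend every none χ)
    reflx Q zero = refl
    reflx Q (suc a) = reflx P a
    tran Q {zero} {b} {zero} p q = refl
    tran Q {zero} {b} {suc c} p q = refl
    tran Q {suc a} {suc b} {suc c} p q = tran P p q
  cone {c} {w} (suc a) i = record
    { rel = twin ; preorder = Q
    ; apex-row = cong suc (C.apex-row) ; apex-column = cong suc (C.apex-column)
    ; size-cone = trans (size-extend (χ zero) (λ i → χ i zero) χ)
        (trans (cong₂ (λ x y → suc x + (y + size χ)) C.apex-row C.apex-column)
        (trans (cong (λ s → suc (suc (a + c)) + (suc a + s)) C.size-cone)
               (solve (a ∷ c ∷ w ∷ [])))) }
    where
    module C = Cone (cone a i)
    χ = C.rel
    P = C.preorder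
    twin = extend (χ zero) (λ i → χ i zero) χ
    Q : Preorder twin
    reflx Q zero = refl
    reflx Q (suc a) = reflx P a
    tran Q {zero} {b} {zero} p q = refl
    tran Q {zero} {zero} {suc c} p q = q
    tran Q {zero} {suc b} {suc c} p q = tran P p q
    tran Q {suc a} {zero} {zero} p q = p
    tran Q {suc a} {suc b} {zero} p q = tran P p q
    tran Q {suc a} {zero} {suc c} p q = tran P p q
    tran Q {suc a} {suc b} {suc c} p q = tran P p q

  join : ∀ a {c w} → InW c w → InW (a + c) (a * (a + c) + w)
  join zero i = i
  join (suc a) {c} i =
    subst (InW (suc a + c)) (Cone.size-cone K) (fromPreorder (Cone.preorder K))
    where K = cone a i

  -- Counting pairs by classes

  term≤sum : ∀ {n} (f : Fin n → ℕ) i → f i ≤ sum f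
  term≤sum f zero = m≤m+n (f zero) _
  term≤sum f (suc i) = ≤-trans (term≤sum (λ j → f (suc j)) i) (m≤n+m _ (f zero))

  positive-sum : ∀ {n} (f : Fin n → Bool) → 1 ≤ sum (λ i → ⟦ f i ⟧) → ∃ λ i → f i ≡ true
  positive-sum {suc n} f h with f zero in eq
  ... | true = zero , eq
  ... | false with positive-sum (λ i → f (suc i)) h
  ...   | i , p = suc i , p

  maximum : ∀ {n} (f : Fin (suc n) → ℕ) → ∃ λ x → ∀ y → f y ≤ f x
  maximum {zero} f = zero , λ { zero → ≤-refl }
  maximum {suc n} f with maximum (λ i → f (suc i))
  ... | x , top with ≤-total (f zero) (f (suc x))
  ...   | inj₁ p = suc x , λ { zero → p ; (suc y) → top y }
  ...   | inj₂ p = zero , λ { zero → ≤-refl ; (suc y) → ≤-trans (top y) p }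

  size≤n² : ∀ {n} (χ : Digraph n) → size χ ≤ n * n
  size≤n² {n} χ = begin
    size χ                        ≤⟨ sum-mono-≤ (λ a → sum-mono-≤ (λ b → ⟦⟧≤1 (χ a b))) ⟩
    sum {n} (λ _ → sum {n} (λ _ → 1))
                                  ≡⟨ sum-cong-≗ {n} (λ _ → trans (sum-const n 1) (*-identityʳ n)) ⟩
    sum {n} (λ _ → n)             ≡⟨ sum-const n n ⟩
    n * n                         ∎
    where
    open ≤-Reasoning
    ⟦⟧≤1 : ∀ b → ⟦ b ⟧ ≤ 1
    ⟦⟧≤1 true = ≤-refl
    ⟦⟧≤1 false = z≤n

  row column class : ∀ {n} → Digraph n → Fin n → ℕ
  row χ x = sum (λ y → ⟦ χ x y ⟧)
  column χ x = sum (λ y → ⟦ χ y x ⟧)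
  class χ x = sum (λ y → ⟦ χ x y ∧ χ y x ⟧)

  class≤row : ∀ {n} (χ : Digraph n) x → class χ x ≤ row χ x
  class≤row χ x = sum-mono-≤ (λ y → ∧≤ˡ (χ x y) (χ y x))
    where
    ∧≤ˡ : ∀ p q → ⟦ p ∧ q ⟧ ≤ ⟦ p ⟧
    ∧≤ˡ true true = ≤-refl
    ∧≤ˡ true false = z≤n
    ∧≤ˡ false q = z≤n

  class≤column : ∀ {n} (χ : Digraph n) x → class χ x ≤ column χ x
  class≤column χ x = sum-mono-≤ (λ y → ∧≤ʳ (χ x y) (χ y x))
    where
    ∧≤ʳ : ∀ p q → ⟦ p ∧ q ⟧ ≤ ⟦ q ⟧
    ∧≤ʳ true q = ≤-refl
    ∧≤ʳ false q = z≤n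

  -- Inclusion-exclusion: only the members of the class of x are counted by both its row and its
  -- column.
  row+column≤ : ∀ {n} (χ : Digraph n) x → row χ x + column χ x ≤ n + class χ x
  row+column≤ {n} χ x = begin
    row χ x + column χ x                              ≡⟨ ∑-distrib-+ _ (λ y → ⟦ χ y x ⟧) ⟨
    sum (λ y → ⟦ χ x y ⟧ + ⟦ χ y x ⟧)                 ≤⟨ sum-mono-≤ (λ y → or (χ x y) (χ y x)) ⟩
    sum (λ y → 1 + ⟦ χ x y ∧ χ y x ⟧)                 ≡⟨ ∑-distrib-+ (λ _ → 1) (λ y → ⟦ χ x y ∧ χ y x ⟧) ⟩
    sum {n} (λ _ → 1) + class χ x  ≡⟨ cong (_+ class χ x) (trans (sum-const n 1) (*-identityʳ n)) ⟩
    n + class χ x                                     ∎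
    where
    open ≤-Reasoning
    or : ∀ p q → ⟦ p ⟧ + ⟦ q ⟧ ≤ 1 + ⟦ p ∧ q ⟧
    or true true = ≤-refl
    or true false = ≤-refl
    or false true = ≤-refl
    or false false = z≤n

  2size≤ : ∀ {n} (χ : Digraph n) → size χ + size χ ≤ n * n + sum (class χ)
  2size≤ {n} χ = begin
    size χ + size χ                     ≡⟨ cong (size χ +_) (∑-comm (λ a b → ⟦ χ a b ⟧)) ⟩
    sum (row χ) + sum (column χ)        ≡⟨ ∑-distrib-+ (row χ) (column χ) ⟨
    sum (λ x → row χ x + column χ x)    ≤⟨ sum-mono-≤ (row+column≤ χ) ⟩
    sum (λ x → n + class χ x)           ≡⟨ ∑-distrib-+ (λ _ → n) (class χ) ⟩
    sum {n} (λ _ → n) + sum (class χ)   ≡⟨ cong (_+ sum (class χ)) (sum-const n n) ⟩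
    n * n + sum (class χ)               ∎
    where open ≤-Reasoning

  ∧-true : ∀ {p q} → p ∧ q ≡ true → p ≡ true × q ≡ true
  ∧-true {true} {true} _ = refl , refl

  true-ext : ∀ {p q} → (p ≡ true → q ≡ true) → (q ≡ true → p ≡ true) → p ≡ q
  true-ext {true} {q} f g = sym (f refl)
  true-ext {false} {true} f g = g refl
  true-ext {false} {false} f g = refl

  _∖_ : ∀ {n} → Digraph (suc n) → Fin (suc n) → Digraph n
  (χ ∖ x) i j = χ (punchIn x i) (punchIn x j)

  module _ {n} {χ : Digraph n} (P : Preorder χ) where

    n≤size : n ≤ size χ
    n≤size = begin
      n                  ≡⟨ trans (sum-const n 1) (*-identityʳ n) ⟨
      sum {n} (λ _ → 1)  ≤⟨ sum-mono-≤ (λ a → ≤-trans (≤-reflexive (sym (cong ⟦_⟧ (reflx P a))))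
                                                      (term≤sum (λ b → ⟦ χ a b ⟧) a)) ⟩
      size χ             ∎
      where open ≤-Reasoning

    row-cong : ∀ {x y} → χ x y ∧ χ y x ≡ true → ∀ z → χ x z ≡ χ y z
    row-cong e z with ∧-true e
    ... | p , q = true-ext (tran P q) (tran P p)

    column-cong : ∀ {x y} → χ x y ∧ χ y x ≡ true → ∀ z → χ z x ≡ χ z y
    column-cong e z with ∧-true e
    ... | p , q = true-ext (λ r → tran P r p) (λ r → tran P r q)

    disjoint-classes : ∀ {x y} → χ x y ∧ χ y x ≡ false → class χ x + class χ y ≤ n
    disjoint-classes {x} {y} e = begin
      class χ x + class χ y   ≡⟨ ∑-distrib-+ _ (λ z → ⟦ χ y z ∧ χ z y ⟧) ⟨
      sum (λ z → ⟦ χ x z ∧ χ z x ⟧ + ⟦ χ y z ∧ χ z y ⟧)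
                              ≤⟨ sum-mono-≤ (λ z → xor (χ x z ∧ χ z x) (χ y z ∧ χ z y) (apart z)) ⟩
      sum {n} (λ _ → 1)       ≡⟨ trans (sum-const n 1) (*-identityʳ n) ⟩
      n                       ∎
      where
      open ≤-Reasoning
      xor : ∀ p q → ¬ (p ≡ true × q ≡ true) → ⟦ p ⟧ + ⟦ q ⟧ ≤ 1
      xor true true h = ⊥-elim (h (refl , refl))
      xor true false h = ≤-refl
      xor false true h = ≤-refl
      xor false false h = z≤n
      apart : ∀ z → ¬ (χ x z ∧ χ z x ≡ true × χ y z ∧ χ z y ≡ true)
      apart z (p , q) with ∧-true p | ∧-true q
      ... | xz , zx | yz , zy = false≢true (trans (sym e) (cong₂ _∧_ (tran P xz zy) (tran P yz zx)))

    -- The a members of the class of x contribute a each. The class of any other vertex is disjoint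
    -- from it, so each of the d other vertices contributes at most d.
    sum-class≤ : ∀ x → (∀ y → class χ y ≤ class χ x) → ∀ d → class χ x + d ≡ n →
      sum (class χ) ≤ class χ x * class χ x + d * d
    sum-class≤ x top d a+d≡n = begin
      sum (class χ)                                  ≤⟨ sum-mono-≤ bound ⟩
      sum (λ y → a * ⟦ e y ⟧ + d * ⟦ not (e y) ⟧)    ≡⟨ ∑-distrib-+ (λ y → a * ⟦ e y ⟧) _ ⟩
      sum (λ y → a * ⟦ e y ⟧) + sum (λ y → d * ⟦ not (e y) ⟧)
        ≡⟨ cong₂ _+_ (*-distribˡ-sum a (λ y → ⟦ e y ⟧)) (*-distribˡ-sum d (λ y → ⟦ not (e y) ⟧)) ⟨
      a * a + d * sum (λ y → ⟦ not (e y) ⟧)          ≡⟨ cong (λ s → a * a + d * s) others ⟩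
      a * a + d * d                                  ∎
      where
      open ≤-Reasoning
      a = class χ x
      e : Fin n → Bool
      e y = χ x y ∧ χ y x
      bound : ∀ y → class χ y ≤ a * ⟦ e y ⟧ + d * ⟦ not (e y) ⟧
      bound y with χ x y ∧ χ y x in eq
      ... | true = ≤-trans (top y) (≤-trans (≤-reflexive (sym (*-identityʳ a))) (m≤m+n _ _))
      ... | false = ≤-trans (+-cancelˡ-≤ a _ _ (≤-trans (disjoint-classes eq) (≤-reflexive (sym a+d≡n))))
                            (≤-reflexive (sym (cong₂ _+_ (*-zeroʳ a) (*-identityʳ d))))
      complement : ∀ b → ⟦ b ⟧ + ⟦ not b ⟧ ≡ 1
      complement true = refl
      complement false = refl
      others : sum (λ y → ⟦ not (e y) ⟧) ≡ d
      others = +-cancelˡ-≡ a _ _ (trans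
        (sym (∑-distrib-+ (λ y → ⟦ e y ⟧) (λ y → ⟦ not (e y) ⟧)))
        (trans (sum-cong-≗ (λ y → complement (e y)))
        (trans (sum-const n 1) (trans (*-identityʳ n) (sym a+d≡n)))))

  -- Deletion of equivalent vertices and the weights it excludes

  module _ {n} {χ : Digraph (suc n)} (P : Preorder χ) (x : Fin (suc n)) where

    ∖-preorder : Preorder (χ ∖ x)
    reflx ∖-preorder a = reflx P _
    tran ∖-preorder p q = tran P p q

    -- The successor compensates for the pair (x, x), which lies in both the row and the column.
    size-∖ : suc (size χ) ≡ size (χ ∖ x) + (row χ x + column χ x)
    size-∖ = begin
      suc (size χ)
        ≡⟨ cong suc (sum-remove {i = x} (row χ)) ⟩
      suc (row χ x + sum (λ i → row χ (punchIn x i)))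
        ≡⟨ cong (λ s → suc (row χ x + s)) (trans
             (sum-cong-≗ (λ i → sum-remove {i = x} (λ j → ⟦ χ (punchIn x i) j ⟧)))
             (∑-distrib-+ (λ i → ⟦ χ (punchIn x i) x ⟧) (λ i → row (χ ∖ x) i))) ⟩
      suc (row χ x + (C + size (χ ∖ x)))
        ≡⟨ rearrange (row χ x) C (size (χ ∖ x)) ⟩
      size (χ ∖ x) + (row χ x + (1 + C))
        ≡⟨ cong (λ b → size (χ ∖ x) + (row χ x + (⟦ b ⟧ + C))) (reflx P x) ⟨
      size (χ ∖ x) + (row χ x + (⟦ χ x x ⟧ + C))
        ≡⟨ cong (λ s → size (χ ∖ x) + (row χ x + s)) (sum-remove {i = x} (λ i → ⟦ χ i x ⟧)) ⟨
      size (χ ∖ x) + (row χ x + column χ x) ∎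
      where
      open ≡-Reasoning
      C = sum (λ i → ⟦ χ (punchIn x i) x ⟧)
      rearrange : ∀ r c s → suc (r + (c + s)) ≡ s + (r + (1 + c))
      rearrange = solve-∀

    -- Equivalent vertices have equal rows, columns and classes, and each of these contains x. So
    -- after the deletion of x the counts of a twin are those of x less one, and the deletion can
    -- continue at the twin.
    module Twin (i : Fin n) (e : χ x (punchIn x i) ∧ χ (punchIn x i) x ≡ true) where
      private
        y = punchIn x i
        split-off : ∀ (f g : Fin (suc n) → Bool) → (∀ z → f z ≡ g z) → g x ≡ true →
          suc (sum (λ j → ⟦ g (punchIn x j) ⟧)) ≡ sum (λ z → ⟦ f z ⟧)
        split-off f g h gx = trans
          (cong (λ b → ⟦ b ⟧ + sum (λ j → ⟦ g (punchIn x j) ⟧)) (sym gx))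
          (trans (sym (sum-remove {i = x} (λ z → ⟦ g z ⟧))) (sum-cong-≗ (λ z → cong ⟦_⟧ (sym (h z)))))

      row-twin : suc (row (χ ∖ x) i) ≡ row χ x
      row-twin = split-off (χ x) (χ y) (row-cong P e) (proj₂ (∧-true {χ x y} e))

      column-twin : suc (column (χ ∖ x) i) ≡ column χ x
      column-twin = split-off (λ z → χ z x) (λ z → χ z y) (column-cong P e) (proj₁ (∧-true {χ x y} e))

      class-twin : suc (class (χ ∖ x) i) ≡ class χ x
      class-twin = split-off (λ z → χ x z ∧ χ z x) (λ z → χ y z ∧ χ z y)
        (λ z → cong₂ _∧_ (row-cong P e z) (column-cong P e z))
        (cong₂ _∧_ (proj₂ (∧-true {χ x y} e)) (proj₁ (∧-true {χ x y} e)))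

    twin : 2 ≤ class χ x → ∃ λ i → χ x (punchIn x i) ∧ χ (punchIn x i) x ≡ true
    twin h = positive-sum (λ i → χ x (punchIn x i) ∧ χ (punchIn x i) x)
      (s≤s⁻¹ (≤-trans h (≤-reflexive (trans (sum-remove {i = x} (λ z → ⟦ χ x z ∧ χ z x ⟧))
        (cong (λ b → ⟦ b ∧ b ⟧ + sum (λ i → ⟦ χ x (punchIn x i) ∧ χ (punchIn x i) x ⟧)) (reflx P x))))))

  -- The formula for deleting m members of one class: their m rows and m columns are all alike, and
  -- together they count the m² pairs among the deleted vertices twice.
  Deletion : ℕ → ∀ {n} c → Digraph n → Fin n → Set
  Deletion m c χ x = ∃ λ (ψ : Digraph c) →
    Preorder ψ × size χ + m * m ≡ size ψ + m * (row χ x + column χ x)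

  delete-suc : ∀ m c {χ : Digraph (suc (m + c))} (P : Preorder χ) x → suc m ≤ class χ x →
    (∀ i → m ≤ class (χ ∖ x) i → Deletion m c (χ ∖ x) i) → Deletion (suc m) c χ x
  delete-suc zero c {χ} P x h _ = χ ∖ x , ∖-preorder P x , (begin
    size χ + 1                                     ≡⟨ +-comm (size χ) 1 ⟩
    suc (size χ)                                   ≡⟨ size-∖ P x ⟩
    size (χ ∖ x) + (row χ x + column χ x)          ≡⟨ cong (size (χ ∖ x) +_) (*-identityˡ _) ⟨
    size (χ ∖ x) + 1 * (row χ x + column χ x)      ∎)
    where open ≡-Reasoning
  delete-suc (suc m) c {χ} P x h rec with twin P x (≤-trans (s≤s (s≤s z≤n)) h)
  ... | i , e with rec i (s≤s⁻¹ (≤-trans h (≤-reflexive (sym (Twin.class-twin P x i e)))))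
  ...   | ψ , Q , eq = ψ , Q ,
    count (suc m) {t = size ψ} (size-∖ P x) eq (Twin.row-twin P x i e) (Twin.column-twin P x i e)
    where
    count : ∀ m {s s′ t r r′ k k′} → suc s ≡ s′ + (r + k) → s′ + m * m ≡ t + m * (r′ + k′) →
      suc r′ ≡ r → suc k′ ≡ k → s + suc m * suc m ≡ t + suc m * (r + k)
    count m {s} {s′} {t} {r} {r′} {k} {k′} p q refl refl = begin
      s + suc m * suc m                           ≡⟨ solve (s ∷ m ∷ []) ⟩
      suc s + (m * m + 2 * m)                     ≡⟨ cong (_+ (m * m + 2 * m)) p ⟩
      s′ + (r + k) + (m * m + 2 * m)              ≡⟨ solve (s′ ∷ r′ ∷ k′ ∷ m ∷ []) ⟩
      s′ + m * m + (r + k + 2 * m)                ≡⟨ cong (_+ (r + k + 2 * m)) q ⟩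
      t + m * (r′ + k′) + (r + k + 2 * m)         ≡⟨ solve (t ∷ r′ ∷ k′ ∷ m ∷ []) ⟩
      t + suc m * (r + k)                         ∎
      where open ≡-Reasoning

  delete : ∀ m c {χ : Digraph (m + c)} → Preorder χ → ∀ x → m ≤ class χ x → Deletion m c χ x
  delete zero c {χ} P x h = χ , P , refl
  delete (suc m) c P x h = delete-suc m c P x h (delete m c (∖-preorder P x))

  -- With a the size of a largest class and d = n ∸ a, the two alternatives rule out the weight k
  -- by the bounds 2k ≤ n² + na and 2k ≤ n² + a² + d².
  SmallClassesExcluded : (n m k : ℕ) → Set
  SmallClassesExcluded n m k = ∀ a d → a + d ≡ n → a < m →
    (n * n + n * a < k + k) ⊎ (n * n + (a * a + d * d) < k + k)

  -- The equation says w = t + m(n + m - ρ) with n = m + c, so w ≥ t + m > c².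
  few-comparable : ∀ m c t {ρ w} → c * c < m + t → suc ρ ≤ m + c + m → w ≤ c * c →
    m * (m + c) + t + m * m ≡ w + m * ρ → ⊥
  few-comparable m c t {ρ} {w} small h w≤ eq = <⇒≱ small (≤-trans
    (linear (m * (m + c) + t + m * m + m * suc ρ) (w + m * ρ + m * (m + c + m)) 0
      (+-mono-≤ (≤-reflexive eq) (*-monoʳ-≤ m h)) (identity m c t ρ w)) w≤)
    where
    identity : ∀ m c t ρ w →
      m + t + (w + m * ρ + m * (m + c + m)) + 0 ≡ w + (m * (m + c) + t + m * m + m * suc ρ)
    identity = solve-∀

  -- The equation describes the deletion of the whole class of a points, with w pairs left on d
  -- points. For positive j and d it gives d ≤ w ≤ t - jd - a, which against t + 2 ≤ a + j + 2d
  -- leaves (j - 1)(d - 1) + 1 ≤ 0. If j = 0, the bounds on ρ contradict each other. If d = 0, the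
  -- bound ρ ≥ 2a gives t ≥ ja, against t + 2 ≤ a + j.
  many-comparable : ∀ m′ j d t {ρ w} → let m = suc m′; a = m + j; n = a + d in
    t + 2 ≤ n + (j + d) → d ≤ w → suc (n + m) ≤ ρ → a + a ≤ ρ → ρ ≤ n + a →
    m * n + t + a * a ≡ w + a * ρ → ⊥
  many-comparable m′ zero d t _ _ h _ h′ _ =
    1+n≰n (≤-trans (≤-trans h h′) (≤-reflexive (cong (suc m′ + 0 + d +_) (+-identityʳ (suc m′)))))
  many-comparable m′ (suc j) zero t {ρ} {w} small _ _ h _ eq =
    1+n≰n {0} (linear _ _ (w + j * (1 + m′ + j))
      (+-mono-≤ (+-mono-≤ (≤-reflexive (sym eq)) small) (*-monoʳ-≤ a h)) (identity m′ j t ρ w))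
    where
    a = suc m′ + suc j
    identity : ∀ m′ j t ρ w → let m = suc m′; a = m + suc j; n = a + 0 in
      1 + (m * n + t + a * a + (n + (suc j + 0)) + a * ρ) + (w + j * (1 + m′ + j))
        ≡ w + a * ρ + (t + 2) + a * (a + a)
    identity = solve-∀
  many-comparable m′ (suc j) (suc d) t {ρ} {w} small d≤w h _ _ eq =
    1+n≰n {0} (linear _ _ (j * d)
      (+-mono-≤ (+-mono-≤ (+-mono-≤ (≤-reflexive (sym eq)) small) (*-monoʳ-≤ a h)) d≤w)
      (identity m′ j d t ρ w))
    where
    a = suc m′ + suc j
    identity : ∀ m′ j d t ρ w → let m = suc m′; a = m + suc j; n = a + suc d in
      1 + (m * n + t + a * a + (n + (suc j + suc d)) + a * ρ + w) + j * d
        ≡ w + a * ρ + (t + 2) + a * suc (n + m) + suc d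
    identity = solve-∀

  deleteAs : ∀ {n} m c → n ≡ m + c → {χ : Digraph n} → Preorder χ → ∀ x → m ≤ class χ x →
    Deletion m c χ x
  deleteAs m c refl = delete m c

  -- Deleting m members of a largest class leaves a preorder on c points; its size is t when the
  -- vertices of the class are related, counted with multiplicity, to n + m vertices.
  gap : ∀ m′ c t → let m = suc m′; n = m + c in
    ¬ InW c t → t + 2 ≤ n + c → c * c < m + t → SmallClassesExcluded n m (m * n + t) →
    ¬ InW n (m * n + t)
  gap m′ c t t∉W t-small c-small excluded k∈W with toPreorder k∈W
  ... | χ , P , size-χ with maximum (class χ)
  ...   | x , top = main
    where
    m = suc m′
    n = m + c
    a = class χ x
    ρ = row χ x + column χ x

    2a≤ρ : a + a ≤ ρ
    2a≤ρ = +-mono-≤ (class≤row χ x) (class≤column χ x)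

    a≤n : a ≤ n
    a≤n = +-cancelʳ-≤ a a n (≤-trans 2a≤ρ (row+column≤ χ x))

    d = proj₁ (m≤n⇒∃[o]m+o≡n a≤n)

    a+d≡n : a + d ≡ n
    a+d≡n = proj₂ (m≤n⇒∃[o]m+o≡n a≤n)

    twice : m * n + t + (m * n + t) ≤ n * n + sum (class χ)
    twice = subst (λ k → k + k ≤ n * n + sum (class χ)) size-χ (2size≤ χ)

    sum-class≤na : sum (class χ) ≤ n * a
    sum-class≤na = ≤-trans (sum-mono-≤ top) (≤-reflexive (sum-const n a))

    main : ⊥
    main with m ≤? a
    ... | no m≰a with excluded a d a+d≡n (≰⇒> m≰a)
    ...   | inj₁ h = <⇒≱ h (≤-trans twice (+-monoʳ-≤ (n * n) sum-class≤na))
    ...   | inj₂ h = <⇒≱ h (≤-trans twice (+-monoʳ-≤ (n * n) (sum-class≤ P x top d a+d≡n)))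
    main | yes m≤a with <-cmp ρ (n + m)
    ... | tri< h _ _ with delete m c P x m≤a
    ...   | ψ , Q , eq = few-comparable m c t c-small h (size≤n² ψ)
                           (subst (λ s → s + m * m ≡ size ψ + m * ρ) size-χ eq)
    main | yes m≤a | tri≈ _ h _ with delete m c P x m≤a
    ...   | ψ , Q , eq = t∉W (subst (InW c) size-ψ (fromPreorder Q))
      where
      exact : ∀ m n t w → m * n + t + m * m ≡ w + m * (n + m) → w ≡ t
      exact m n t w eq = +-cancelʳ-≡ (m * (n + m)) w t (trans (sym eq) (solve (m ∷ n ∷ t ∷ [])))
      size-ψ : size ψ ≡ t
      size-ψ = exact m n t (size ψ)
        (trans (cong (_+ m * m) (sym size-χ)) (trans eq (cong (λ r → size ψ + m * r) h)))
    main | yes m≤a | tri> _ _ h with m≤n⇒∃[o]m+o≡n m≤a | deleteAs a d (sym a+d≡n) P x ≤-refl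
    ...   | j , m+j≡a | ψ , Q , eq = close m+j≡a c≡j+d
      where
      c≡j+d : c ≡ j + d
      c≡j+d = +-cancelˡ-≡ m _ _
        (trans (sym a+d≡n) (trans (cong (_+ d) (sym m+j≡a)) (+-assoc m j d)))
      close : m + j ≡ a → c ≡ j + d → ⊥
      close e₁ e₂ = many-comparable m′ j d t
        (subst (t + 2 ≤_) (cong₂ _+_ n≡ e₂) t-small) (n≤size Q)
        (subst (λ v → suc (v + m) ≤ ρ) n≡ h)
        (subst (λ v → v + v ≤ ρ) (sym e₁) 2a≤ρ)
        (subst (λ v → ρ ≤ v) (cong₂ _+_ n≡ (sym e₁)) (row+column≤ χ x))
        (trans (cong₂ (λ u v → m * u + t + v * v) (sym n≡) e₁)
          (trans (cong (_+ a * a) (sym size-χ)) (trans eq (cong (λ v → size ψ + v * ρ) (sym e₁)))))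
        where
        n≡ : n ≡ m + j + d
        n≡ = trans (sym a+d≡n) (cong (_+ d) (sym e₁))

  -- Initial runs of attained weights

  discrete : ∀ n → InW n n
  discrete zero = fromPreorder {0} {λ ()} (record { reflx = λ () ; tran = λ { {()} } })
  discrete (suc n) = isolate (discrete n)

  complete : ∀ n → InW n (n * n)
  complete n = subst (λ v → InW v (n * v)) (+-identityʳ n)
    (subst (InW (n + 0)) (+-identityʳ (n * (n + 0))) (join n (discrete 0)))

  star : ∀ n i → i ≤ n → InW (suc n) (suc n + i)
  star zero zero _ = discrete 1
  star (suc n) i i≤ with i ≤? n
  ... | yes p = isolate (star n i p)
  ... | no p with ≤-antisym i≤ (≰⇒> p)
  ...   | refl = subst (InW (2 + n)) (cong (_+ suc n) (*-identityˡ (2 + n))) (join 1 (discrete (suc n)))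

  run-star : ∀ n → InitialRun (suc n) (suc n + n)
  run-star n k p q with m≤n⇒∃[o]m+o≡n p
  ... | i , refl = star n i (+-cancelˡ-≤ (suc n) i n q)

  run-suc : ∀ {c e} → InitialRun c e → InitialRun (suc c) (suc e)
  run-suc R (suc k) (s≤s p) (s≤s q) = isolate (R k p q)

  -- Consecutive levels m n + W(c), with m + c = n, overlap once the initial run of W(c + 1) is
  -- long enough.
  run-levels : ∀ m c {e e′} → InitialRun c e → InitialRun (suc c) e′ → m + c + c ≤ suc e′ →
    InitialRun (m + c) (m * (m + c) + e)
  run-levels zero c R _ _ = R
  run-levels (suc m) c {e} {e′} R R′ h k p q with k ≤? m * (suc m + c) + e′
  -- For the lower levels the run of W(c + 2) obtained by adding an isolated point suffices: it is
  -- longer by one, and the overlap condition is stronger by one.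
  ... | yes k≤ = subst (λ v → InitialRun v (m * v + e′)) (+-suc m c)
                   (run-levels m (suc c) R′ (run-suc R′) bound)
                   k p k≤
    where
    bound : m + suc c + suc c ≤ suc (suc e′)
    bound = ≤-trans (≤-reflexive (shift m c)) (s≤s h)
      where
      shift : ∀ m c → m + suc c + suc c ≡ suc (suc m + c + c)
      shift = solve-∀
  ... | no k≰ with m≤n⇒∃[o]m+o≡n {suc m * (suc m + c) + c} {k} below
    where
    -- Overlap: k exceeds the end of the level below, and n + c ≤ e′ + 1, so k has already reached
    -- the start of the next level.
    below : suc m * (suc m + c) + c ≤ k
    below = linear (suc m + c + c + suc (m * (suc m + c) + e′)) (suc e′ + k) 0
      (+-mono-≤ h (≰⇒> k≰)) (solve (m ∷ c ∷ e′ ∷ k ∷ []))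
  ...   | i , refl = subst (InW (suc m + c)) (sym (+-assoc (suc m * (suc m + c)) c i))
    (join (suc m) (R (c + i) (m≤m+n c i) (+-cancelˡ-≤ (suc m * (suc m + c)) (c + i) e
      (≤-trans (≤-reflexive (sym (+-assoc (suc m * (suc m + c)) c i))) q))))

  -- The recurrence for b under explicit side conditions

  IsB-maximal : ∀ {n b m} → IsB n b → InitialRun n m → m ≤ b
  IsB-maximal {b = b} {m} (_ , stop) R with m ≤? b
  ... | yes p = p
  ... | no p = ⊥-elim (stop (λ k x y → R k x (≤-trans y (≰⇒> p))))

  IsB-unique : ∀ {n b b′} → IsB n b → IsB n b′ → b ≡ b′
  IsB-unique B B′ = ≤-antisym (IsB-maximal B′ (proj₁ B)) (IsB-maximal B (proj₁ B′))

  IsB-∉ : ∀ {n b} → IsB n b → ¬ InW n (suc b)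
  IsB-∉ {b = b} (R , stop) i = stop λ k p q → extendBy k p (m≤n⇒m<n∨m≡n q)
    where
    extendBy : ∀ k → _ ≤ k → k < suc b ⊎ k ≡ suc b → _
    extendBy k p (inj₁ q) = R k p (s≤s⁻¹ q)
    extendBy k p (inj₂ refl) = i

  IsB-intro : ∀ {n b} → n ≤ suc b → InitialRun n b → ¬ InW n (suc b) → IsB n b
  IsB-intro {n} {b} h R i = R , λ R′ → i (R′ (suc b) h ≤-refl)

  -- ℓ(c) ≤ n < ℓ(c + 1), where b(c) = e and b(c + 1) = e′.
  record Level (n c : ℕ) : Set where
    constructor level
    field
      e e′ : ℕ
      isB : IsB c e
      isB′ : IsB (suc c) e′
      lower : e + 3 ≤ n + c
      upper : n + c ≤ suc e′

  recurrence-from : ∀ m′ c → let n = suc m′ + c in (L : Level n c) → c ≤ suc (Level.e L) →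
    c * c < suc m′ + suc (Level.e L) →
    SmallClassesExcluded n (suc m′) (suc m′ * n + suc (Level.e L)) →
    IsB n (suc m′ * n + Level.e L)
  recurrence-from m′ c (level e e′ B B′ lo up) c≤e sq excluded =
    IsB-intro (≤-trans (m≤m+n n (m′ * n)) (≤-trans (m≤m+n (suc m′ * n) e) (n≤1+n _)))
      (run-levels (suc m′) c (proj₁ B) (proj₁ B′) up)
      (subst (λ k → ¬ InW n k) (+-suc (suc m′ * n) e)
        (gap m′ c (suc e) (IsB-∉ B) (≤-trans (≤-reflexive (sym (+-suc e 2))) lo) sq excluded))
    where n = suc m′ + c

  smallClasses-linear : ∀ {n m k} → n * n + n * m < k + k + n → SmallClassesExcluded n m k
  smallClasses-linear {n} {m} {k} h a d _ a<m =
    inj₁ (linear (suc (n * n + n * m) + n * suc a) (k + k + n + n * m) 0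
      (+-mono-≤ h (*-monoʳ-≤ n a<m)) (identity n m a k))
    where
    identity : ∀ n m a k →
      suc (n * n + n * a) + (k + k + n + n * m) + 0 ≡ k + k + (suc (n * n + n * m) + n * suc a)
    identity = solve-∀

  -- For a ≤ c the bound n² + na suffices, as n ≥ 3c. For c < a < m both a and d lie between c + 1
  -- and m - 1, so by convexity a² + d² is at most (c + 1)² + (m - 1)²; the last hypothesis is
  -- exactly what this extreme case needs.
  smallClasses : ∀ m c t → 3 * c ≤ m + c → 1 ≤ t → suc c * suc c < m + c + t →
    SmallClassesExcluded (m + c) m (m * (m + c) + t)
  smallClasses m c t 3c≤n 1≤t sq a d a+d≡n a<m with a ≤? c
  ... | yes a≤c = inj₁ (linear {suc (n * n + n * a)} {k + k}
          (n * (3 * c) + n * a + 1) (n * (m + c) + n * c + t) t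
          (+-mono-≤ (+-mono-≤ (*-monoʳ-≤ n 3c≤n) (*-monoʳ-≤ n a≤c)) 1≤t) (identity m c t a))
    where
    n = m + c
    k = m * n + t
    identity : ∀ m c t a → let n = m + c; k = m * n + t in
      suc (n * n + n * a) + (n * (m + c) + n * c + t) + t ≡ k + k + (n * (3 * c) + n * a + 1)
    identity = solve-∀
  ... | no a≰c with m≤n⇒∃[o]m+o≡n (≰⇒> a≰c) | m≤n⇒∃[o]m+o≡n a<m
  ...   | i , refl | j , refl with +-cancelˡ-≡ a d (suc (j + c)) (trans a+d≡n (solve (c ∷ i ∷ j ∷ [])))
  ...     | refl = inj₂ (linear (2 * suc (suc c * suc c)) (2 * (m + c + t)) (1 + 2 * (i * j))
            (*-monoʳ-≤ 2 sq) (identity c i j t))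
    where
    identity : ∀ c i j t → let a = suc c + i; d = suc (j + c); m = suc (a + j); n = m + c; k = m * n + t in
      suc (n * n + (a * a + d * d)) + 2 * (m + c + t) + (1 + 2 * (i * j))
        ≡ k + k + 2 * suc (suc c * suc c)
    identity = solve-∀

  recurrence-generic : ∀ m c → let n = m + c in (L : Level n c) → 1 ≤ m → c ≤ suc (Level.e L) →
    3 * c ≤ n → suc c * suc c < n + suc (Level.e L) → IsB n (m * n + Level.e L)
  recurrence-generic (suc m′) c L _ c≤e 3c≤n sq =
    recurrence-from m′ c L c≤e
      (linear (suc (suc c * suc c)) (suc m′ + c + suc e) (suc c) sq (identity m′ c e))
      (smallClasses (suc m′) c (suc e) 3c≤n (s≤s z≤n) sq)
    where
    e = Level.e L
    identity : ∀ m′ c e → 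
      suc (c * c) + (suc m′ + c + suc e) + suc c ≡ suc m′ + suc e + suc (suc c * suc c)
    identity = solve-∀

  -- The values of b up to 8

  b1 : IsB 1 1
  b1 = IsB-intro (s≤s z≤n) (run-star 0) λ i → too-big i
    where
    too-big : ¬ InW 1 2
    too-big i with toPreorder i
    ... | χ , _ , eq = <⇒≱ (from-yes (2 ≤? 2)) (≤-trans (≤-reflexive (sym eq)) (size≤n² χ))

  b2 : IsB 2 4
  b2 = IsB-intro (from-yes (2 ≤? 5)) run too-big
    where
    too-big : ¬ InW 2 5
    too-big i with toPreorder i
    ... | χ , _ , eq = <⇒≱ (from-yes (5 ≤? 5)) (≤-trans (≤-reflexive (sym eq)) (size≤n² χ))
    run : InitialRun 2 4
    run k p q with m≤n⇒m<n∨m≡n q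
    ... | inj₁ r = run-star 1 k p (s≤s⁻¹ r)
    ... | inj₂ refl = complete 2

  b3 : IsB 3 7
  b3 = recurrence-generic 2 1 (level 1 4 b1 b2 (from-yes (4 ≤? 4)) (from-yes (4 ≤? 5)))
    (from-yes (1 ≤? 2)) (from-yes (1 ≤? 2)) (from-yes (3 ≤? 3)) (from-yes (5 ≤? 5))

  b4 : IsB 4 13
  b4 = recurrence-generic 3 1 (level 1 4 b1 b2 (from-yes (4 ≤? 5)) (from-yes (5 ≤? 5)))
    (from-yes (1 ≤? 3)) (from-yes (1 ≤? 2)) (from-yes (3 ≤? 4)) (from-yes (5 ≤? 6))

  -- For c = 2, n = 5 and for c = 3, n = 7 the generic estimate just fails.
  b5 : IsB 5 19
  b5 = recurrence-from 2 2 (level 4 7 b2 b3 (from-yes (7 ≤? 7)) (from-yes (7 ≤? 8)))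
    (from-yes (2 ≤? 5)) (from-yes (5 ≤? 8)) (smallClasses-linear {5} {3} {20} (from-yes (41 ≤? 45)))

  b6 : IsB 6 28
  b6 = recurrence-generic 4 2 (level 4 7 b2 b3 (from-yes (7 ≤? 8)) (from-yes (8 ≤? 8)))
    (from-yes (1 ≤? 4)) (from-yes (2 ≤? 5)) (from-yes (6 ≤? 6)) (from-yes (10 ≤? 11))

  b7 : IsB 7 35
  b7 = recurrence-from 3 3 (level 7 13 b3 b4 (from-yes (10 ≤? 10)) (from-yes (10 ≤? 14)))
    (from-yes (3 ≤? 8)) (from-yes (10 ≤? 12)) (smallClasses-linear {7} {4} {36} (from-yes (78 ≤? 79)))

  -- The exceptional value: two cliques of size 4 give 48 = 4 ⋅ 8 + 16, which is one more than the
  -- recurrence predicts. The number n of vertices stays a variable because comparing types InW 8 k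
  -- by unfolding them is expensive.
  join-at : ∀ a c w {n k} → InW c w → a + c ≡ n → a * (a + c) + w ≡ k → InW n k
  join-at a c w i refl refl = join a i

  run-eight : ∀ {n} → 8 ≡ n → InitialRun n 52
  run-eight {n} eq k p q = split (k ≤? 47)
    where
    low : InitialRun n 47
    low = subst₂ InitialRun {5 + 3} {n} {5 * (5 + 3) + 7} {47} eq refl
      (run-levels 5 3 {7} {13} (proj₁ b3) (proj₁ b4) (from-yes (11 ≤? 14)))
    high : ∀ i → i ≤ 4 → InW n (48 + i)
    high 0 _ = join-at 4 4 (4 * 4) (complete 4) eq refl
    high 1 _ = join-at 5 3 (3 * 3) (complete 3) eq refl
    high 2 _ = join-at 6 2 2 (discrete 2) eq refl
    high 3 _ = join-at 6 2 3 (proj₁ b2 3 (from-yes (2 ≤? 3)) (from-yes (3 ≤? 4))) eq refl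
    high 4 _ = join-at 6 2 (2 * 2) (complete 2) eq refl
    high (suc (suc (suc (suc (suc _))))) (s≤s (s≤s (s≤s (s≤s ()))))
    split : Dec (k ≤ 47) → InW n k
    split (yes r) = low k p r
    split (no r) = beyond (m≤n⇒∃[o]m+o≡n (≰⇒> r))
      where
      beyond : (∃ λ i → 48 + i ≡ k) → InW n k
      beyond (i , e) = subst (InW n) e (high i (+-cancelˡ-≤ 48 i 4 (≤-trans (≤-reflexive e) q)))

  b8 : IsB 8 52
  b8 = IsB-intro (from-yes (8 ≤? 53)) (run-eight refl) (not-53 refl)
    where
    not-53 : ∀ {n} → n ≡ 8 → ¬ InW n 53
    -- The run has spilled over into the level 6 ⋅ 8 + W(2), so the gap is found with c = 2 although
    -- ζ(8) = 3.
    not-53 {n} eq i = gap 5 2 5 (IsB-∉ b2) (from-yes (7 ≤? 10)) (from-yes (5 ≤? 11))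
      (smallClasses 6 2 5 (from-yes (6 ≤? 8)) (from-yes (1 ≤? 5)) (from-yes (10 ≤? 13)))
      (subst₂ InW {n} {6 + 2} {53} {6 * (6 + 2) + 5} eq refl i)

  -- Bounds on b and the recurrence for all n

  record Bounds (n b : ℕ) : Set where
    constructor bounds
    field
      -- The factor 2/3 is preserved because n² - cn ≥ 2n²/3 when 3c ≤ n. The bound `flat` says ℓ(n)
      -- ≤ n² - 2n + 5, and `wide` yields ζ(n) + 2 ≤ n.
      quadratic : 2 * (n * n) + 1 ≤ 3 * b
      flat : b + n ≤ n * n + 2
      wide : 2 * n ≤ suc b

  below-level : ∀ {n c e} → e + 3 ≤ n + c → Bounds c e → suc (suc c) ≤ n
  below-level {n} {c} {e} lo (bounds _ _ w) =
    linear (2 * c + (e + 3)) (suc e + (n + c)) 0 (+-mono-≤ w lo) (identity n c e)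
    where
    identity : ∀ n c e → suc (suc c) + (suc e + (n + c)) + 0 ≡ n + (2 * c + (e + 3))
    identity = solve-∀

  recurrence-exact : ∀ {c e n b} → IsB c e → IsB n b → ∀ m → m + c ≡ n → m * n + e ≡ b →
    (L : Level (m + c) c) → IsB (m + c) (m * (m + c) + Level.e L)
  recurrence-exact B B′ m refl refl L with IsB-unique B (Level.isB L)
  ... | refl = B′

  Level-floor : ∀ {n c e} → IsB c e → ∀ k → e + 3 ≡ k + c → Level n c → k ≤ n
  Level-floor {n} {c} B k e+3≡ (level _ _ B′ _ lo _) with IsB-unique B B′
  ... | refl = +-cancelʳ-≤ c k n (≤-trans (≤-reflexive (sym e+3≡)) lo)

  recurrence-at : ∀ m {c e} → let n = m + c in IsB c e → (L : Level n c) → Bounds c (Level.e L) →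
    c ≤ suc e → 3 * c ≤ n → suc c * suc c < n + suc e → IsB n (m * n + Level.e L)
  recurrence-at m {c} B L I h₁ h₂ h₃ with IsB-unique B (Level.isB L)
  ... | refl = recurrence-generic m c L
    (+-cancelʳ-≤ c 1 m (≤-trans (n≤1+n (suc c)) (below-level (Level.lower L) I))) h₁ h₂ h₃

  recurrence-above : ∀ m {c e} → let n = m + c in IsB c e → (L : Level n c) → Bounds c (Level.e L) →
    ∀ k → k ≤ n → c ≤ suc e → 3 * c ≤ k → suc c * suc c < k + suc e → IsB n (m * n + Level.e L)
  recurrence-above m {e = e} B L I k k≤n h₁ h₂ h₃ =
    recurrence-at m B L I h₁ (≤-trans h₂ k≤n) (≤-trans h₃ (+-monoˡ-≤ (suc e) k≤n))

  -- With n ≥ ℓ(c), the quadratic bound reduces (c + 1)² < n + b(c) + 1 to (c - 1)(c - 8) ≥ 0; this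
  -- is why the exact values of b are needed up to 7.
  recurrence-large : ∀ m j → let c = 8 + j; n = m + c in (L : Level n c) → Bounds c (Level.e L) →
    IsB n (m * n + Level.e L)
  recurrence-large m j L@(level e _ B _ lo _) I@(bounds q _ w) = recurrence-at m B L I
    (linear (2 * c) (suc e) c w (id₀ c e))
    (*-cancelˡ-≤ 3 (linear (2 * (c * c) + 1 + 3 * (e + 3)) (3 * e + 3 * (m + c + c))
      (42 + 20 * j + 2 * (j * j)) (+-mono-≤ q (*-monoʳ-≤ 3 lo)) (id₁ m j e)))
    (*-cancelˡ-≤ 3 (linear (2 * (2 * (c * c) + 1) + 3 * (e + 3)) (2 * (3 * e) + 3 * (m + c + c))
      (j * j + 7 * j) (+-mono-≤ (*-monoʳ-≤ 2 q) (*-monoʳ-≤ 3 lo)) (id₂ m j e)))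
    where
    c = 8 + j
    id₀ : ∀ c e → c + suc e + c ≡ suc e + 2 * c
    id₀ = solve-∀
    id₁ : ∀ m j e → let c = 8 + j in
      3 * (3 * c) + (3 * e + 3 * (m + c + c)) + (42 + 20 * j + 2 * (j * j))
        ≡ 3 * (m + c) + (2 * (c * c) + 1 + 3 * (e + 3))
    id₁ = solve-∀
    id₂ : ∀ m j e → let c = 8 + j in
      3 * suc (suc c * suc c) + (2 * (3 * e) + 3 * (m + c + c)) + (j * j + 7 * j)
        ≡ 3 * (m + c + suc e) + (2 * (2 * (c * c) + 1) + 3 * (e + 3))
    id₂ = solve-∀

  recurrence : ∀ m c → let n = m + c in (L : Level n c) → Bounds c (Level.e L) → 1 ≤ c → n ≢ 8 →
    IsB n (m * n + Level.e L)
  -- The numeral after `I` is a lower bound for n. It is ℓ(c), except for c = 2 and c = 3, where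
  -- ℓ(c) < 3c and the values n = 5, 7, 8 are split off.
  recurrence m 1 L I _ _ = recurrence-above m b1 L I 3 (Level-floor b1 3 refl L)
    (from-yes (1 ≤? 2)) (from-yes (3 ≤? 3)) (from-yes (5 ≤? 5))
  recurrence m 2 L I _ _ = split (m ≟ 3)
    where
    split : Dec (m ≡ 3) → IsB (m + 2) (m * (m + 2) + Level.e L)
    split (yes p) = recurrence-exact b2 b5 m (cong (_+ 2) p) (cong (λ m → m * 5 + 4) p) L
    split (no m≢3) = recurrence-above m b2 L I 6
      (+-monoˡ-≤ 2 (≤∧≢⇒< (+-cancelʳ-≤ 2 3 m (Level-floor b2 5 refl L)) (λ e → m≢3 (sym e))))
      (from-yes (2 ≤? 5)) (from-yes (6 ≤? 6)) (from-yes (10 ≤? 11))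
  recurrence m 3 L I _ n≢8 = split (m ≟ 4)
    where
    split : Dec (m ≡ 4) → IsB (m + 3) (m * (m + 3) + Level.e L)
    split (yes p) = recurrence-exact b3 b7 m (cong (_+ 3) p) (cong (λ m → m * 7 + 7) p) L
    split (no m≢4) = recurrence-above m b3 L I 9
      (+-monoˡ-≤ 3 (≤∧≢⇒< (≤∧≢⇒< (+-cancelʳ-≤ 3 4 m (Level-floor b3 7 refl L)) (λ e → m≢4 (sym e)))
                           (λ e → n≢8 (cong (_+ 3) (sym e)))))
      (from-yes (3 ≤? 8)) (from-yes (9 ≤? 9)) (from-yes (17 ≤? 17))
  recurrence m 4 L I _ _ = recurrence-above m b4 L I 12 (Level-floor b4 12 refl L)
    (from-yes (4 ≤? 14)) (from-yes (12 ≤? 12)) (from-yes (26 ≤? 26))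
  recurrence m 5 L I _ _ = recurrence-above m b5 L I 17 (Level-floor b5 17 refl L)
    (from-yes (5 ≤? 20)) (from-yes (15 ≤? 17)) (from-yes (37 ≤? 37))
  recurrence m 6 L I _ _ = recurrence-above m b6 L I 25 (Level-floor b6 25 refl L)
    (from-yes (6 ≤? 29)) (from-yes (18 ≤? 25)) (from-yes (50 ≤? 54))
  recurrence m 7 L I _ _ = recurrence-above m b7 L I 31 (Level-floor b7 31 refl L)
    (from-yes (7 ≤? 36)) (from-yes (21 ≤? 31)) (from-yes (65 ≤? 67))
  recurrence m (suc (suc (suc (suc (suc (suc (suc (suc j)))))))) L I _ _ = recurrence-large m j L I

  Known : ℕ → Set
  Known n = ∃ λ b → IsB n b × Bounds n b

  record Zeta (n : ℕ) : Set where
    constructor zeta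
    field
      c : ℕ
      1≤c : 1 ≤ c
      at : Level n c
      bounds-c : Bounds c (Level.e at)
      bounds-c′ : Bounds (suc c) (Level.e′ at)

  -- The search climbs from c = 1 as long as ℓ(c) ≤ n. Then `wide` forces c + 2 ≤ n, so b(c + 1) is
  -- supplied by the induction and the fuel n cannot run out.
  find-zeta : ∀ {n} → 3 ≤ n → (∀ {m} → m < n → 1 ≤ m → Known m) → Zeta n
  find-zeta {n} 3≤n known = search n 1 ≤-refl (m≤n+m n 1) b1
      (bounds (from-yes (3 ≤? 3)) (from-yes (2 ≤? 3)) (from-yes (2 ≤? 2)))
      (≤-trans (from-yes (4 ≤? 4)) (+-monoˡ-≤ 1 3≤n))
    where
    search : ∀ fuel c {e} → 1 ≤ c → n ≤ c + fuel → IsB c e → Bounds c e → e + 3 ≤ n + c → Zeta n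
    search zero c 1≤c n≤ B I lo =
      ⊥-elim (<⇒≱ (below-level lo I) (≤-trans n≤ (≤-trans (≤-reflexive (+-identityʳ c)) (n≤1+n c))))
    search (suc fuel) c {e} 1≤c n≤ B I lo with known (below-level lo I) (s≤s z≤n)
    ... | e′ , B′ , I′ with e′ + 3 ≤? n + suc c
    ...   | yes lo′ = search fuel (suc c) (s≤s z≤n) (≤-trans n≤ (≤-reflexive (+-suc c fuel))) B′ I′ lo′
    ...   | no ¬lo′ = zeta c 1≤c (level e e′ B B′ lo
              (linear (suc (n + suc c)) (e′ + 3) 0 (≰⇒> ¬lo′) (identity n c e′))) I I′
      where
      identity : ∀ n c e′ → n + c + (e′ + 3) + 0 ≡ suc e′ + suc (n + suc c)
      identity = solve-∀

  third-large : ∀ {n} j → let c = 5 + j in (L : Level n c) → Bounds c (Level.e L) → 3 * c ≤ n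
  third-large {n} j (level e _ _ _ lo _) (bounds q _ _) =
    *-cancelˡ-≤ 3 (linear (2 * (c * c) + 1 + 3 * (e + 3)) (3 * e + 3 * (n + c)) (8 * j + 2 * (j * j))
      (+-mono-≤ q (*-monoʳ-≤ 3 lo)) (identity n j e))
    where
    c = 5 + j
    identity : ∀ n j e → let c = 5 + j in
      3 * (3 * c) + (3 * e + 3 * (n + c)) + (8 * j + 2 * (j * j))
        ≡ 3 * n + (2 * (c * c) + 1 + 3 * (e + 3))
    identity = solve-∀

  -- The inequality fails only at n = 5, 7, 8, hence the start at 9.
  third : ∀ {n} c → 9 ≤ n → (L : Level n c) → Bounds c (Level.e L) → 3 * c ≤ n
  third 0 _ _ _ = z≤n
  third 1 9≤n _ _ = ≤-trans (from-yes (3 ≤? 9)) 9≤n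
  third 2 9≤n _ _ = ≤-trans (from-yes (6 ≤? 9)) 9≤n
  third 3 9≤n _ _ = 9≤n
  third 4 _ L _ = Level-floor b4 12 refl L
  third (suc (suc (suc (suc (suc j))))) _ L I = third-large j L I

  known-step : ∀ m c → let n = m + c in 9 ≤ n → 1 ≤ c → (L : Level n c) → Bounds c (Level.e L) →
    Known n
  known-step m c 9≤n 1≤c L@(level e e′ B B′ lo up) I@(bounds q _ w) =
    m * n + e ,
    recurrence m c L I 1≤c (λ { n≡8 → <⇒≱ 9≤n (≤-reflexive n≡8) }) ,
    bounds (linear (3 * c * n + (2 * (c * c) + 1)) (n * n + 3 * e) (2 * (c * c))
                   (+-mono-≤ (*-monoˡ-≤ n 3c≤n) q) (id₁ m c e))
           (flat c 1≤c 9≤n L)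
           (linear (2 * n) (m * n) (suc e) (*-monoˡ-≤ n 2≤m) (id₂ m c e))
    where
    n = m + c
    3c≤n = third c 9≤n L I
    2≤m : 2 ≤ m
    2≤m = +-cancelʳ-≤ c 2 m (below-level lo I)
    id₁ : ∀ m c e → let n = m + c in
      2 * (n * n) + 1 + (n * n + 3 * e) + (2 * (c * c))
        ≡ 3 * (m * n + e) + (3 * c * n + (2 * (c * c) + 1))
    id₁ = solve-∀
    id₂ : ∀ m c e → let n = m + c in 2 * n + m * n + suc e ≡ suc (m * n + e) + 2 * n
    id₂ = solve-∀
    flat : ∀ c → 1 ≤ c → 9 ≤ m + c → (L : Level (m + c) c) →
      m * (m + c) + Level.e L + (m + c) ≤ (m + c) * (m + c) + 2
    flat 1 _ 9≤n (level _ _ _ B′ _ up) = ⊥-elim (<⇒≱ (from-yes (6 ≤? 9))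
      (≤-trans 9≤n (≤-trans (m≤m+n (m + 1) 1) (subst (λ b → m + 1 + 1 ≤ suc b) (IsB-unique B′ b2) up))))
    flat (suc (suc j)) _ _ (level e _ _ _ lo _) =
      linear (e + 3) (m + (2 + j) + (2 + j)) (j * (m + j) + j + 3) lo (identity m j e)
      where
      identity : ∀ m j e → let c = 2 + j in
        m * (m + c) + e + (m + c) + (m + c + c) + (j * (m + j) + j + 3)
          ≡ (m + c) * (m + c) + 2 + (e + 3)
      identity = solve-∀

  known-small : ∀ n → 1 ≤ n → n ≤ 8 → Known n
  known-small 1 _ _ = 1 , b1 , bounds (from-yes (3 ≤? 3)) (from-yes (2 ≤? 3)) (from-yes (2 ≤? 2))
  known-small 2 _ _ = 4 , b2 , bounds (from-yes (9 ≤? 12)) (from-yes (6 ≤? 6)) (from-yes (4 ≤? 5))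
  known-small 3 _ _ = 7 , b3 , bounds (from-yes (19 ≤? 21)) (from-yes (10 ≤? 11)) (from-yes (6 ≤? 8))
  known-small 4 _ _ = 13 , b4 , bounds (from-yes (33 ≤? 39)) (from-yes (17 ≤? 18)) (from-yes (8 ≤? 14))
  known-small 5 _ _ = 19 , b5 , bounds (from-yes (51 ≤? 57)) (from-yes (24 ≤? 27)) (from-yes (10 ≤? 20))
  known-small 6 _ _ = 28 , b6 , bounds (from-yes (73 ≤? 84)) (from-yes (34 ≤? 38)) (from-yes (12 ≤? 29))
  known-small 7 _ _ = 35 , b7 , bounds (from-yes (99 ≤? 105)) (from-yes (42 ≤? 51)) (from-yes (14 ≤? 36))
  known-small 8 _ _ = 52 , b8 , bounds (from-yes (129 ≤? 156)) (from-yes (60 ≤? 66)) (from-yes (16 ≤? 53))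
  known-small (suc (suc (suc (suc (suc (suc (suc (suc (suc _))))))))) _
    (s≤s (s≤s (s≤s (s≤s (s≤s (s≤s (s≤s (s≤s ()))))))))

  known-large : ∀ {n} → 9 ≤ n → Zeta n → Known n
  known-large {n} 9≤n (zeta c 1≤c L I _) = by-excess (m≤n⇒∃[o]m+o≡n c≤n) 9≤n L I
    where
    c≤n : c ≤ n
    c≤n = ≤-trans (n≤1+n c) (<⇒≤ (below-level (Level.lower L) I))
    by-excess : ∀ {n} → (∃ λ m → c + m ≡ n) → 9 ≤ n → (L : Level n c) → Bounds c (Level.e L) →
      Known n
    by-excess (m , refl) = subst (λ n → 9 ≤ n → (L : Level n c) → Bounds c (Level.e L) → Known n)
      (+-comm m c) (λ 9≤n → known-step m c 9≤n 1≤c)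

  known : ∀ n → 1 ≤ n → Known n
  known = <-rec _ step
    where
    step : ∀ n → (∀ {m} → m < n → 1 ≤ m → Known m) → 1 ≤ n → Known n
    step n rec 1≤n = split (n ≤? 8)
      where
      split : Dec (n ≤ 8) → Known n
      split (yes n≤8) = known-small n 1≤n n≤8
      split (no n≰8) = known-large (≰⇒> n≰8)
        (find-zeta (≤-trans (from-yes (3 ≤? 9)) (≰⇒> n≰8)) rec)

  zeta-exists : ∀ n → 3 ≤ n → Zeta n
  zeta-exists n 3≤n = find-zeta 3≤n (λ {m} _ → known m)

  bounds-of : ∀ {n b} → 1 ≤ n → IsB n b → Bounds n b
  bounds-of {n} 1≤n B with known n 1≤n
  ... | b , B′ , I = subst (Bounds n) (IsB-unique B′ B) I

-- Rational approximation of iterated square roots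

module Roots where

  open import Data.Nat as ℕ using (ℕ; zero; suc)
  import Data.Nat.Properties as ℕ
  import Data.Nat.Tactic.RingSolver as ℕSolver
  open import Data.Integer as ℤ using ()
  import Data.Integer.Properties as ℤ
  open import Data.Nat.Coprimality using (1-coprimeTo) renaming (sym to coprime-sym)
  open import Data.Rational
  open import Data.Rational.Properties
  open import Data.Rational.Solver
  open +-*-Solver
  open import Data.Fin using (Fin; zero; suc; toℕ)
  open import Data.Product using (∃; _×_; _,_; proj₁; proj₂)
  open import Data.Sum using (_⊎_; inj₁; inj₂)
  open import Data.Empty using (⊥; ⊥-elim)
  open import Relation.Nullary using (Dec; yes; no)
  open import Relation.Nullary.Decidable using (from-yes)
  open import Relation.Binary.PropositionalEquality
    using (_≡_; _≢_; refl; sym; trans; cong; cong₂; subst; subst₂)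
  open Weights using (linear; Level; level; Bounds; bounds; Zeta; zeta; zeta-exists; bounds-of;
    recurrence; below-level; run-levels; IsB-maximal; IsB-unique; b1; b2; b8)

  -- The division by 1 normalises through a gcd, which is stuck on a variable; the explicit fraction
  -- computes.
  fromℕ≡ : ∀ k → fromℕ k ≡ mkℚ (ℤ.+ k) 0 (coprime-sym (1-coprimeTo k))
  fromℕ≡ k = normalize-coprime (coprime-sym (1-coprimeTo k))

  fromℕ-+ : ∀ a b → fromℕ (a ℕ.+ b) ≡ fromℕ a + fromℕ b
  fromℕ-+ a b = sym (trans (cong₂ _+_ (fromℕ≡ a) (fromℕ≡ b))
    (cong (_/ 1) (cong₂ ℤ._+_ (ℤ.*-identityʳ (ℤ.+ a)) (ℤ.*-identityʳ (ℤ.+ b)))))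

  fromℕ-* : ∀ a b → fromℕ (a ℕ.* b) ≡ fromℕ a * fromℕ b
  fromℕ-* a b = sym (trans (cong₂ _*_ (fromℕ≡ a) (fromℕ≡ b))
    (cong (_/ 1) (sym (ℤ.pos-* a b))))

  fromℕ-≤ : ∀ a b → a ℕ.≤ b → fromℕ a ≤ fromℕ b
  fromℕ-≤ a b h = subst₂ _≤_ (sym (fromℕ≡ a)) (sym (fromℕ≡ b))
    (*≤* (ℤ.*-monoʳ-≤-nonNeg (ℤ.+ 1) (ℤ.+≤+ h)))

  fromℕ-< : ∀ a b → a ℕ.< b → fromℕ a < fromℕ b
  fromℕ-< a b h = subst₂ _<_ (sym (fromℕ≡ a)) (sym (fromℕ≡ b))
    (*<* (ℤ.*-monoʳ-<-pos (ℤ.+ 1) (ℤ.+<+ h)))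

  -- Certificates as over the naturals. Strictness comes from the slack here and from the hypothesis
  -- in `linear<′`.
  linear< : ∀ {a b} S T s → S ≤ T → 0ℚ < s → a + T + s ≡ b + S → a < b
  linear< {a} {b} S T s S≤T 0<s e = ≰⇒> λ b≤a → <-irrefl refl (begin-strict
    b + S      ≤⟨ +-mono-≤ b≤a S≤T ⟩
    a + T      ≡⟨ +-identityʳ (a + T) ⟨
    a + T + 0ℚ <⟨ +-monoʳ-< (a + T) 0<s ⟩
    a + T + s  ≡⟨ e ⟩
    b + S      ∎)
    where open ≤-Reasoning

  linear<′ : ∀ {a b} S T → S < T → a + T ≡ b + S → a < b
  linear<′ {a} {b} S T S<T e = ≰⇒> λ b≤a → <-irrefl refl (begin-strict
    b + S      <⟨ +-mono-≤-< b≤a S<T ⟩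
    a + T      ≡⟨ e ⟩
    b + S      ∎)
    where open ≤-Reasoning

  linear≤ : ∀ {a b} S T → S ≤ T → a + T ≡ b + S → a ≤ b
  linear≤ {a} {b} S T S≤T e = ≮⇒≥ λ b<a → <-irrefl refl (begin-strict
    b + S      <⟨ +-mono-<-≤ b<a S≤T ⟩
    a + T      ≡⟨ e ⟩
    b + S      ∎)
    where open ≤-Reasoning

  *-mono-< : ∀ {p q} → 0ℚ ≤ p → p < q → p * p < q * q
  *-mono-< {p} {q} 0≤p p<q = begin-strict
    p * p ≤⟨ *-monoˡ-≤-nonNeg p {{nonNegative 0≤p}} (<⇒≤ p<q) ⟩
    p * q <⟨ *-monoˡ-<-pos q {{positive (≤-<-trans 0≤p p<q)}} p<q ⟩
    q * q ∎
    where open ≤-Reasoning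

  *-cancel-< : ∀ {p q} → 0ℚ ≤ q → p * p < q * q → p < q
  *-cancel-< {p} {q} 0≤q h = ≰⇒> λ q≤p → <-irrefl refl (<-≤-trans h (≤-trans
    (*-monoˡ-≤-nonNeg q {{nonNegative 0≤q}} q≤p)
    (*-monoʳ-≤-nonNeg p {{nonNegative (≤-trans 0≤q q≤p)}} q≤p)))

  0≤square : ∀ p → 0ℚ ≤ p * p
  0≤square p with ≤-total 0ℚ p
  ... | inj₁ 0≤p = ≤-trans (≤-reflexive (sym (*-zeroʳ p))) (*-monoˡ-≤-nonNeg p {{nonNegative 0≤p}} 0≤p)
  ... | inj₂ p≤0 = ≤-trans (≤-reflexive (sym (*-zeroʳ p))) (*-monoˡ-≤-nonPos p {{nonPositive p≤0}} p≤0)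

  0<c+kt² : ∀ c k .{{_ : Positive c}} .{{_ : NonNegative k}} t → 0ℚ < c + k * (t * t)
  0<c+kt² c k t = begin-strict
    0ℚ               <⟨ positive⁻¹ c ⟩
    c                ≡⟨ +-identityʳ c ⟨
    c + 0ℚ           ≡⟨ cong (c +_) (*-zeroʳ k) ⟨
    c + k * 0ℚ       ≤⟨ +-monoʳ-≤ c (*-monoˡ-≤-nonNeg k (0≤square t)) ⟩
    c + k * (t * t)  ∎
    where open ≤-Reasoning

  ^ℚ-+ : ∀ q a b → q ^ℚ (a ℕ.+ b) ≡ (q ^ℚ a) * (q ^ℚ b)
  ^ℚ-+ q zero b = sym (*-identityˡ _)
  ^ℚ-+ q (suc a) b = trans (cong (q *_) (^ℚ-+ q a b)) (sym (*-assoc q _ _))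

  ^ℚ-double : ∀ q k → q ^ℚ (2 ℕ.* k) ≡ (q ^ℚ k) * (q ^ℚ k)
  ^ℚ-double q k = trans (cong (λ j → q ^ℚ (k ℕ.+ j)) (ℕ.+-identityʳ k)) (^ℚ-+ q k k)

  ^ℚ-nonNeg : ∀ q k → 0ℚ ≤ q → 0ℚ ≤ q ^ℚ k
  ^ℚ-nonNeg q zero 0≤q = from-yes (0ℚ ≤? 1ℚ)
  ^ℚ-nonNeg q (suc k) 0≤q = ≤-trans (≤-reflexive (sym (*-zeroʳ q)))
    (*-monoˡ-≤-nonNeg q {{nonNegative 0≤q}} (^ℚ-nonNeg q k 0≤q))

  square : ∀ q → q ^ℚ 2 ≡ q * q
  square q = cong (q *_) (*-identityʳ q)

  -- Sequences of approximate roots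

  cons : ∀ {N} → ℚ → (Fin N → ℚ) → Fin (suc N) → ℚ
  cons p q zero = p
  cons p q (suc i) = q i

  rWith-cons : ∀ N p (q : Fin N → ℚ) → rWith (suc N) (cons p q) ≡ p + ½ * (rWith N q - 1ℚ)
  rWith-cons N p q = solve 3 (λ p w h →
      (p :+ con ½ :* w :- con 1ℚ) :+ con (ℤ.+ 2 / 1) :* (con ½ :* h)
        := p :+ con ½ :* ((w :- con 1ℚ) :+ con (ℤ.+ 2 / 1) :* h :- con 1ℚ))
    refl p (weightedSum q) (pow½ N)

  -- A lower approximation that works for every N, 0 included; it settles the small values of z.
  rWith-ones : ∀ N → rWith N (λ _ → 1ℚ) ≡ 1ℚ
  rWith-ones zero = refl
  rWith-ones (suc N) = trans (rWith-cons N 1ℚ (λ _ → 1ℚ))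
    (cong (λ r → 1ℚ + ½ * (r - 1ℚ)) (rWith-ones N))

  RootsBelow RootsAbove : ℚ → ∀ {N} → (Fin N → ℚ) → Set
  RootsBelow x q = ∀ i → 0ℚ ≤ q i × (q i ^ℚ (2 ℕ.^ suc (toℕ i))) < x
  RootsAbove x q = ∀ i → 0ℚ < q i × x < (q i ^ℚ (2 ℕ.^ suc (toℕ i)))

  ones-below : ∀ {x} N → 1ℚ < x → RootsBelow x {N} (λ _ → 1ℚ)
  ones-below {x} N 1<x i = from-yes (0ℚ ≤? 1ℚ) , subst (_< x) (sym (1^ (2 ℕ.^ suc (toℕ i)))) 1<x
    where
    1^ : ∀ k → 1ℚ ^ℚ k ≡ 1ℚ
    1^ zero = refl
    1^ (suc k) = trans (*-identityˡ _) (1^ k)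

  -- The later entries approximate roots of the rational p rather than of √x; squaring carries their
  -- bounds over to p², hence to x.
  cons-below : ∀ {x p N} {q : Fin N → ℚ} → 0ℚ ≤ p → p * p < x → RootsBelow p q → RootsBelow x (cons p q)
  cons-below {x} {p} 0≤p h R zero = 0≤p , subst (_< x) (sym (square p)) h
  cons-below {x} {p} {q = q} 0≤p h R (suc i) = proj₁ (R i) ,
    subst (_< x) (sym (^ℚ-double (q i) k))
      (<-trans (*-mono-< (^ℚ-nonNeg (q i) k (proj₁ (R i))) (proj₂ (R i))) h)
    where k = 2 ℕ.^ suc (toℕ i)

  cons-above : ∀ {x p N} {q : Fin N → ℚ} → 0ℚ < p → x < p * p → RootsAbove p q → RootsAbove x (cons p q)
  cons-above {x} {p} 0<p h R zero = 0<p , subst (x <_) (sym (square p)) h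
  cons-above {x} {p} {q = q} 0<p h R (suc i) = proj₁ (R i) ,
    subst (x <_) (sym (^ℚ-double (q i) k))
      (<-trans h (*-mono-< (<⇒≤ 0<p) (proj₂ (R i))))
    where k = 2 ℕ.^ suc (toℕ i)

  tower : ℕ → ℚ
  tower N = fromℕ (5 ℕ.^ (2 ℕ.^ N))

  tower-suc : ∀ N → tower (suc N) ≡ tower N * tower N
  tower-suc N = trans (cong fromℕ (trans
      (cong (λ k → 5 ℕ.^ (2 ℕ.^ N ℕ.+ k)) (ℕ.+-identityʳ (2 ℕ.^ N)))
      (ℕ.^-distribˡ-+-* 5 (2 ℕ.^ N) (2 ℕ.^ N))))
    (fromℕ-* (5 ℕ.^ (2 ℕ.^ N)) (5 ℕ.^ (2 ℕ.^ N)))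

  0≤tower : ∀ N → 0ℚ ≤ tower N
  0≤tower N = fromℕ-≤ 0 (5 ℕ.^ (2 ℕ.^ N)) ℕ.z≤n

  -- Inequalities for a single square root

  infix 8 _⁄_

  _⁄_ : (a d : ℕ) .{{_ : ℕ.NonZero d}} → ℚ
  a ⁄ d = ℤ.+ a / d

  scale : ∀ k .{{_ : NonNegative k}} {a b} → a ≤ b → k * a ≤ k * b
  scale k = *-monoˡ-≤-nonNeg k

  -- Here and in upper-root, b and e stand for b(z) and b(y) with y = ζ(z); the slack is a positive
  -- constant plus a multiple of a square.
  lower-root : ∀ z y b e → (z - y) * z + e ≤ b → 2 ⁄ 1 * (y * y) + 1ℚ ≤ 3 ⁄ 1 * e → z ≤ y * y + 3 ⁄ 1 →
    (z - ½ * y - 3 ⁄ 5) * (z - ½ * y - 3 ⁄ 5) < b - z + 3 ⁄ 1 - ½ * z - 3 ⁄ 5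
  lower-root z y b e h₁ h₂ h₃ = linear<
    ((z - y) * z + e + 1 ⁄ 3 * (2 ⁄ 1 * (y * y) + 1ℚ) + 3 ⁄ 10 * z)
    (b + 1 ⁄ 3 * (3 ⁄ 1 * e) + 3 ⁄ 10 * (y * y + 3 ⁄ 1))
    (737 ⁄ 1050 + 7 ⁄ 60 * ((y - 18 ⁄ 7) * (y - 18 ⁄ 7)))
    (+-mono-≤ (+-mono-≤ h₁ (scale (1 ⁄ 3) h₂)) (scale (3 ⁄ 10) h₃))
    (0<c+kt² (737 ⁄ 1050) (7 ⁄ 60) (y - 18 ⁄ 7))
    (solve 4 (λ z y b e →
      (z :- con ½ :* y :- con (3 ⁄ 5)) :* (z :- con ½ :* y :- con (3 ⁄ 5)) :+ (b :+ con (1 ⁄ 3)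
        :* (con (3 ⁄ 1) :* e) :+ con (3 ⁄ 10) :* (y :* y :+ con (3 ⁄ 1))) :+ (con (737 ⁄ 1050)
        :+ con (7 ⁄ 60) :* ((y :- con (18 ⁄ 7)) :* (y :- con (18 ⁄ 7))))
        := b :- z :+ con (3 ⁄ 1) :- con ½ :* z :- con (3 ⁄ 5) :+ ((z :- y) :* z :+ e :+ con (1 ⁄ 3)
          :* (con (2 ⁄ 1) :* (y :* y) :+ con 1ℚ) :+ con (3 ⁄ 10) :* z))
      refl z y b e)

  -- For the first root n ≥ ℓ(z) is available without the loss z/2 + 3/5 of the later ones, so the
  -- offset 3/5 improves to 3/10.
  first-root : ∀ z y b e → (z - y) * z + e ≤ b → 2 ⁄ 1 * (y * y) + 1ℚ ≤ 3 ⁄ 1 * e → z ≤ y * y + 3 ⁄ 1 →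
    (z - ½ * y - 3 ⁄ 10) * (z - ½ * y - 3 ⁄ 10) < b - z + 3 ⁄ 1
  first-root z y b e h₁ h₂ h₃ = linear<
    ((z - y) * z + e + 1 ⁄ 3 * (2 ⁄ 1 * (y * y) + 1ℚ) + 2 ⁄ 5 * z)
    (b + 1 ⁄ 3 * (3 ⁄ 1 * e) + 2 ⁄ 5 * (y * y + 3 ⁄ 1))
    (52 ⁄ 75 + 1 ⁄ 60 * ((y - 9 ⁄ 1) * (y - 9 ⁄ 1)))
    (+-mono-≤ (+-mono-≤ h₁ (scale (1 ⁄ 3) h₂)) (scale (2 ⁄ 5) h₃))
    (0<c+kt² (52 ⁄ 75) (1 ⁄ 60) (y - 9 ⁄ 1))
    (solve 4 (λ z y b e →
      (z :- con ½ :* y :- con (3 ⁄ 10)) :* (z :- con ½ :* y :- con (3 ⁄ 10)) :+ (b :+ con (1 ⁄ 3)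
        :* (con (3 ⁄ 1) :* e) :+ con (2 ⁄ 5) :* (y :* y :+ con (3 ⁄ 1))) :+ (con (52 ⁄ 75)
        :+ con (1 ⁄ 60) :* ((y :- con (9 ⁄ 1)) :* (y :- con (9 ⁄ 1))))
        := b :- z :+ con (3 ⁄ 1) :+ ((z :- y) :* z :+ e :+ con (1 ⁄ 3) :* (con (2 ⁄ 1) :* (y :* y)
          :+ con 1ℚ) :+ con (2 ⁄ 5) :* z))
      refl z y b e)

  upper-root : ∀ z y b e → b ≤ (z - y) * z + e → e + 3 ⁄ 1 ≤ z + y → 2 ⁄ 1 * y ≤ 1ℚ + e →
    b - z + 3 ⁄ 1 < (z - ½ * y + 2 ⁄ 5) * (z - ½ * y + 2 ⁄ 5)
  upper-root z y b e h₁ h₂ h₃ = linear<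
    (b + 9 ⁄ 5 * (e + 3 ⁄ 1) + 4 ⁄ 5 * (2 ⁄ 1 * y))
    ((z - y) * z + e + 9 ⁄ 5 * (z + y) + 4 ⁄ 5 * (1ℚ + e))
    (7 ⁄ 5 + 1 ⁄ 4 * ((y - 6 ⁄ 5) * (y - 6 ⁄ 5)))
    (+-mono-≤ (+-mono-≤ h₁ (scale (9 ⁄ 5) h₂)) (scale (4 ⁄ 5) h₃))
    (0<c+kt² (7 ⁄ 5) (1 ⁄ 4) (y - 6 ⁄ 5))
    (solve 4 (λ z y b e →
      b :- z :+ con (3 ⁄ 1) :+ ((z :- y) :* z :+ e :+ con (9 ⁄ 5) :* (z :+ y) :+ con (4 ⁄ 5)
        :* (con 1ℚ :+ e)) :+ (con (7 ⁄ 5) :+ con (1 ⁄ 4) :* ((y :- con (6 ⁄ 5)) :* (y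
        :- con (6 ⁄ 5))))
        := (z :- con ½ :* y :+ con (2 ⁄ 5)) :* (z :- con ½ :* y :+ con (2 ⁄ 5)) :+ (b
          :+ con (9 ⁄ 5) :* (e :+ con (3 ⁄ 1)) :+ con (4 ⁄ 5) :* (con (2 ⁄ 1) :* y)))
      refl z y b e)

  -- The exceptional b(8) = 52 is compared directly: at y = 3 the claim is 47 < 6.9² = 47.61, which
  -- the offset 7/20 in place of 2/5 would miss.
  upper-root-8 : ∀ y → y ≤ 3 ⁄ 1 →
    52 ⁄ 1 - 8 ⁄ 1 + 3 ⁄ 1 < (8 ⁄ 1 - ½ * y + 2 ⁄ 5) * (8 ⁄ 1 - ½ * y + 2 ⁄ 5)
  upper-root-8 y h = linear<
    (69 ⁄ 10 * y)
    (69 ⁄ 10 * 3 ⁄ 1)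
    (61 ⁄ 100 + 1 ⁄ 4 * ((3 ⁄ 1 - y) * (3 ⁄ 1 - y)))
    (scale (69 ⁄ 10) h)
    (0<c+kt² (61 ⁄ 100) (1 ⁄ 4) (3 ⁄ 1 - y))
    (solve 1 (λ y →
      con (52 ⁄ 1) :- con (8 ⁄ 1) :+ con (3 ⁄ 1) :+ (con (69 ⁄ 10) :* con (3 ⁄ 1))
        :+ (con (61 ⁄ 100) :+ con (1 ⁄ 4) :* ((con (3 ⁄ 1) :- y) :* (con (3 ⁄ 1) :- y)))
        := (con (8 ⁄ 1) :- con ½ :* y :+ con (2 ⁄ 5)) :* (con (8 ⁄ 1) :- con ½ :* y :+ con (2 ⁄ 5))
          :+ (con (69 ⁄ 10) :* y))
      refl y)

  -- Excludes x < 5, the case where no root is left. At z = 3 the right side is only 4.9, whereas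
  -- the unshifted ℓ(3) = 7 of `ell-large` already exceeds 5.
  threshold-large : ∀ z b → 4 ⁄ 1 ≤ z → 2 ⁄ 1 * (z * z) + 1ℚ ≤ 3 ⁄ 1 * b →
    5 ⁄ 1 < b - z + 3 ⁄ 1 - ½ * z - 3 ⁄ 5
  threshold-large z b h₁ h₂ = linear<
    (1 ⁄ 3 * (2 ⁄ 1 * (z * z) + 1ℚ) + 23 ⁄ 6 * 4 ⁄ 1)
    (1 ⁄ 3 * (3 ⁄ 1 * b) + 23 ⁄ 6 * z)
    (12 ⁄ 5 + 2 ⁄ 3 * ((z - 4 ⁄ 1) * (z - 4 ⁄ 1)))
    (+-mono-≤ (scale (1 ⁄ 3) h₂) (scale (23 ⁄ 6) h₁))
    (0<c+kt² (12 ⁄ 5) (2 ⁄ 3) (z - 4 ⁄ 1))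
    (solve 2 (λ z b →
      con (5 ⁄ 1) :+ (con (1 ⁄ 3) :* (con (3 ⁄ 1) :* b) :+ con (23 ⁄ 6) :* z) :+ (con (12 ⁄ 5)
        :+ con (2 ⁄ 3) :* ((z :- con (4 ⁄ 1)) :* (z :- con (4 ⁄ 1))))
        := b :- z :+ con (3 ⁄ 1) :- con ½ :* z :- con (3 ⁄ 5) :+ (con (1 ⁄ 3) :* (con (2 ⁄ 1) :* (z
          :* z) :+ con 1ℚ) :+ con (23 ⁄ 6) :* con (4 ⁄ 1)))
      refl z b)

  ell-large : ∀ z b → 3 ⁄ 1 ≤ z → 2 ⁄ 1 * (z * z) + 1ℚ ≤ 3 ⁄ 1 * b → 5 ⁄ 1 < b - z + 3 ⁄ 1
  ell-large z b h₁ h₂ = linear<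
    (1 ⁄ 3 * (2 ⁄ 1 * (z * z) + 1ℚ) + 3 ⁄ 1 * 3 ⁄ 1)
    (1 ⁄ 3 * (3 ⁄ 1 * b) + 3 ⁄ 1 * z)
    (4 ⁄ 3 + 2 ⁄ 3 * ((z - 3 ⁄ 1) * (z - 3 ⁄ 1)))
    (+-mono-≤ (scale (1 ⁄ 3) h₂) (scale (3 ⁄ 1) h₁))
    (0<c+kt² (4 ⁄ 3) (2 ⁄ 3) (z - 3 ⁄ 1))
    (solve 2 (λ z b →
      con (5 ⁄ 1) :+ (con (1 ⁄ 3) :* (con (3 ⁄ 1) :* b) :+ con (3 ⁄ 1) :* z) :+ (con (4 ⁄ 3)
        :+ con (2 ⁄ 3) :* ((z :- con (3 ⁄ 1)) :* (z :- con (3 ⁄ 1))))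
        := b :- z :+ con (3 ⁄ 1) :+ (con (1 ⁄ 3) :* (con (2 ⁄ 1) :* (z :* z) :+ con 1ℚ)
          :+ con (3 ⁄ 1) :* con (3 ⁄ 1)))
      refl z b)

  1<lower-root : ∀ z y → y + 2 ⁄ 1 ≤ z → 3 ⁄ 1 ≤ z → 1ℚ < (z - ½ * y - 3 ⁄ 5)
  1<lower-root z y h₁ h₂ = linear<
    (½ * (y + 2 ⁄ 1) + ½ * 3 ⁄ 1)
    (½ * z + ½ * z)
    (9 ⁄ 10)
    (+-mono-≤ (scale (½) h₁) (scale (½) h₂))
    (positive⁻¹ (9 ⁄ 10))
    (solve 2 (λ z y →
      con 1ℚ :+ (con ½ :* z :+ con ½ :* z) :+ (con (9 ⁄ 10))
        := (z :- con ½ :* y :- con (3 ⁄ 5)) :+ (con ½ :* (y :+ con (2 ⁄ 1)) :+ con ½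
          :* con (3 ⁄ 1)))
      refl z y)

  roots-ordered : ∀ z y → (z - ½ * y - 3 ⁄ 5) < (z - ½ * y - 3 ⁄ 10)
  roots-ordered z y  = linear<
    (0ℚ)
    (0ℚ)
    (3 ⁄ 10)
    ≤-refl
    (positive⁻¹ (3 ⁄ 10))
    (solve 2 (λ z y →
      (z :- con ½ :* y :- con (3 ⁄ 5)) :+ (con 0ℚ) :+ (con (3 ⁄ 10))
        := (z :- con ½ :* y :- con (3 ⁄ 10)) :+ (con 0ℚ))
      refl z y)

  lower-threshold : ∀ z y e → e + 3 ⁄ 1 ≤ z + y →
    e - y + 3 ⁄ 1 - ½ * y - 3 ⁄ 5 ≤ (z - ½ * y - 3 ⁄ 5)
  lower-threshold z y e h = linear≤
    (e + 3 ⁄ 1)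
    (z + y)
    h
    (solve 3 (λ z y e →
      e :- y :+ con (3 ⁄ 1) :- con ½ :* y :- con (3 ⁄ 5) :+ (z :+ y)
        := (z :- con ½ :* y :- con (3 ⁄ 5)) :+ (e :+ con (3 ⁄ 1)))
      refl z y e)

  -- The error 11/5 is the fixed point of s = 3/5 + (s + 1)/2.
  lower-step : ∀ z y r → y - 11 ⁄ 5 < r → z - 11 ⁄ 5 < (z - ½ * y - 3 ⁄ 5) + ½ * (r - 1ℚ)
  lower-step z y r h = linear<′
    (½ * (y - 11 ⁄ 5))
    (½ * r)
    (*-monoʳ-<-pos ½ h)
    (solve 3 (λ z y r →
      z :- con (11 ⁄ 5) :+ (con ½ :* r)
        := (z :- con ½ :* y :- con (3 ⁄ 5)) :+ con ½ :* (r :- con 1ℚ) :+ (con ½ :* (y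
          :- con (11 ⁄ 5))))
      refl z y r)

  lower-final : ∀ z y r → y - 11 ⁄ 5 < r → z - 397 ⁄ 200 < (z - ½ * y - 3 ⁄ 10) + ½ * (r - 1ℚ)
  lower-final z y r h = linear<
    (½ * (y - 11 ⁄ 5))
    (½ * r)
    (17 ⁄ 200)
    (scale ½ (<⇒≤ h))
    (positive⁻¹ (17 ⁄ 200))
    (solve 3 (λ z y r →
      z :- con (397 ⁄ 200) :+ (con ½ :* r) :+ (con (17 ⁄ 200))
        := (z :- con ½ :* y :- con (3 ⁄ 10)) :+ con ½ :* (r :- con 1ℚ) :+ (con ½ :* (y
          :- con (11 ⁄ 5))))
      refl z y r)

  upper-threshold : ∀ z y e → z + y ≤ 1ℚ + e → 0ℚ ≤ y → (z - ½ * y + 2 ⁄ 5) < e - (1ℚ + y) + 3 ⁄ 1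
  upper-threshold z y e h₁ h₂ = linear<
    (z + y + ½ * 0ℚ)
    (1ℚ + e + ½ * y)
    (3 ⁄ 5)
    (+-mono-≤ h₁ (scale (½) h₂))
    (positive⁻¹ (3 ⁄ 5))
    (solve 3 (λ z y e →
      (z :- con ½ :* y :+ con (2 ⁄ 5)) :+ (con 1ℚ :+ e :+ con ½ :* y) :+ (con (3 ⁄ 5))
        := e :- (con 1ℚ :+ y) :+ con (3 ⁄ 1) :+ (z :+ y :+ con ½ :* con 0ℚ))
      refl z y e)

  0<upper-root : ∀ z y → y + 2 ⁄ 1 ≤ z → 0ℚ ≤ y → 0ℚ < (z - ½ * y + 2 ⁄ 5)
  0<upper-root z y h₁ h₂ = linear<
    (y + 2 ⁄ 1 + ½ * 0ℚ)
    (z + ½ * y)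
    (12 ⁄ 5)
    (+-mono-≤ h₁ (scale (½) h₂))
    (positive⁻¹ (12 ⁄ 5))
    (solve 2 (λ z y →
      con 0ℚ :+ (z :+ con ½ :* y) :+ (con (12 ⁄ 5))
        := (z :- con ½ :* y :+ con (2 ⁄ 5)) :+ (y :+ con (2 ⁄ 1) :+ con ½ :* con 0ℚ))
      refl z y)

  -- The 1 added to y cancels against the 1 subtracted from r, so the error 4/5 is the fixed point
  -- of s = 2/5 + s/2.
  upper-step : ∀ z y r → r < 1ℚ + y + 4 ⁄ 5 → (z - ½ * y + 2 ⁄ 5) + ½ * (r - 1ℚ) < z + 4 ⁄ 5
  upper-step z y r h = linear<′
    (½ * r)
    (½ * (1ℚ + y + 4 ⁄ 5))
    (*-monoʳ-<-pos ½ h)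
    (solve 3 (λ z y r →
      (z :- con ½ :* y :+ con (2 ⁄ 5)) :+ con ½ :* (r :- con 1ℚ) :+ (con ½ :* (con 1ℚ :+ y
        :+ con (4 ⁄ 5)))
        := z :+ con (4 ⁄ 5) :+ (con ½ :* r))
      refl z y r)

  upper-final : ∀ z r → r < 1ℚ + z + 4 ⁄ 5 → r < z + 397 ⁄ 200
  upper-final z r h = linear<
    (r)
    (1ℚ + z + 4 ⁄ 5)
    (37 ⁄ 200)
    (<⇒≤ h)
    (positive⁻¹ (37 ⁄ 200))
    (solve 2 (λ z r →
      r :+ (con 1ℚ :+ z :+ con (4 ⁄ 5)) :+ (con (37 ⁄ 200)) := z :+ con (397 ⁄ 200) :+ (r))
      refl z r)

  -- Descent from z to ζ(z) and the resulting bounds on r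

  record _↦_ (a : ℕ) (p : ℚ) : Set where
    constructor maps
    field image : fromℕ a ≡ p

  ⌜_⌝ : ∀ a → a ↦ fromℕ a
  ⌜ a ⌝ = maps refl

  infixl 6 _⊕_
  infixl 7 _⊗_

  _⊕_ : ∀ {a b p q} → a ↦ p → b ↦ q → (a ℕ.+ b) ↦ (p + q)
  _⊕_ {a} {b} (maps refl) (maps refl) = maps (fromℕ-+ a b)

  _⊗_ : ∀ {a b p q} → a ↦ p → b ↦ q → (a ℕ.* b) ↦ (p * q)
  _⊗_ {a} {b} (maps refl) (maps refl) = maps (fromℕ-* a b)

  difference : ∀ m y {z} → m ℕ.+ y ≡ z → m ↦ (fromℕ z - fromℕ y)
  difference m y refl = maps (trans
    (solve 2 (λ m y → m := m :+ y :- y) refl (fromℕ m) (fromℕ y))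
    (cong (_- fromℕ y) (sym (fromℕ-+ m y))))

  ≤-image : ∀ {a b p q} → a ↦ p → b ↦ q → a ℕ.≤ b → p ≤ q
  ≤-image {a} {b} (maps refl) (maps refl) = fromℕ-≤ a b

  -- Attained levels bound b(z) from below for every z; only the bound from above has to make room
  -- for z = 8.
  record Descent (z b : ℕ) : Set where
    field
      y e e′ : ℕ
      1≤y : 1 ℕ.≤ y
      isB : IsB y e
      isB′ : IsB (suc y) e′
      level-below : (fromℕ z - fromℕ y) * fromℕ z + fromℕ e ≤ fromℕ b
      level-above : fromℕ b ≤ (fromℕ z - fromℕ y) * fromℕ z + fromℕ e ⊎
                    (z ≡ 8 × b ≡ 52 × fromℕ y ≤ 3 ⁄ 1)
      quadratic : 2 ⁄ 1 * (fromℕ y * fromℕ y) + 1ℚ ≤ 3 ⁄ 1 * fromℕ e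
      wide : 2 ⁄ 1 * fromℕ y ≤ 1ℚ + fromℕ e
      growth : fromℕ z ≤ fromℕ y * fromℕ y + 3 ⁄ 1
      lower : fromℕ e + 3 ⁄ 1 ≤ fromℕ z + fromℕ y
      upper : fromℕ z + fromℕ y ≤ 1ℚ + fromℕ e′
      gap-y : fromℕ y + 2 ⁄ 1 ≤ fromℕ z

  descent : ∀ {z b} → 3 ℕ.≤ z → IsB z b → Descent z b
  descent {z} {b} 3≤z B with zeta-exists z 3≤z
  ... | zeta y 1≤y L@(level e e′ B₁ B₂ lo up) I@(bounds q _ w) (bounds _ f _) = record
    { y = y ; e = e ; e′ = e′ ; 1≤y = 1≤y ; isB = B₁ ; isB′ = B₂
    ; level-below = ≤-image (difference m y m+y≡z ⊗ ⌜ z ⌝ ⊕ ⌜ e ⌝) ⌜ b ⌝ (below m m+y≡z L B)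
    ; level-above = above (z ℕ.≟ 8)
    ; quadratic = ≤-image (⌜ 2 ⌝ ⊗ (⌜ y ⌝ ⊗ ⌜ y ⌝) ⊕ ⌜ 1 ⌝) (⌜ 3 ⌝ ⊗ ⌜ e ⌝) q
    ; wide = ≤-image (⌜ 2 ⌝ ⊗ ⌜ y ⌝) (⌜ 1 ⌝ ⊕ ⌜ e ⌝) w
    -- z < ℓ(y + 1), and `flat` at y + 1 gives ℓ(y + 1) ≤ y² + 4.
    ; growth = ≤-image ⌜ z ⌝ (⌜ y ⌝ ⊗ ⌜ y ⌝ ⊕ ⌜ 3 ⌝)
        (linear (z ℕ.+ y ℕ.+ (e′ ℕ.+ suc y)) (suc e′ ℕ.+ (suc y ℕ.* suc y ℕ.+ 2)) 0
          (ℕ.+-mono-≤ up f) (growth-identity z y e′))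
    ; lower = ≤-image (⌜ e ⌝ ⊕ ⌜ 3 ⌝) (⌜ z ⌝ ⊕ ⌜ y ⌝) lo
    ; upper = ≤-image (⌜ z ⌝ ⊕ ⌜ y ⌝) (⌜ 1 ⌝ ⊕ ⌜ e′ ⌝) up
    ; gap-y = ≤-image (⌜ y ⌝ ⊕ ⌜ 2 ⌝) ⌜ z ⌝ (ℕ.≤-trans (ℕ.≤-reflexive (ℕ.+-comm y 2)) 2+y≤z)
    }
    where
    2+y≤z : suc (suc y) ℕ.≤ z
    2+y≤z = below-level lo I
    m = z ℕ.∸ y
    m+y≡z : m ℕ.+ y ≡ z
    m+y≡z = ℕ.m∸n+n≡m (ℕ.≤-trans (ℕ.m≤n+m y 2) 2+y≤z)
    growth-identity : ∀ z y e′ → z ℕ.+ (suc e′ ℕ.+ (suc y ℕ.* suc y ℕ.+ 2)) ℕ.+ 0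
      ≡ y ℕ.* y ℕ.+ 3 ℕ.+ (z ℕ.+ y ℕ.+ (e′ ℕ.+ suc y))
    growth-identity = ℕSolver.solve-∀
    below : ∀ m {z} → m ℕ.+ y ≡ z → (L : Level z y) → IsB z b → m ℕ.* z ℕ.+ Level.e L ℕ.≤ b
    below m refl L B = IsB-maximal B
      (run-levels m y (proj₁ (Level.isB L)) (proj₁ (Level.isB′ L)) (Level.upper L))
    generic : ∀ m {z} → m ℕ.+ y ≡ z → (L : Level z y) → Bounds y (Level.e L) → IsB z b → z ≢ 8 →
      b ℕ.≤ m ℕ.* z ℕ.+ Level.e L
    generic m refl L I B z≢8 = ℕ.≤-reflexive (IsB-unique B (recurrence m y L I 1≤y z≢8))
    y≤3 : ∀ y {e} → Bounds y e → e ℕ.+ 3 ℕ.≤ 8 ℕ.+ y → y ℕ.≤ 3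
    y≤3 0 _ _ = from-yes (0 ℕ.≤? 3)
    y≤3 1 _ _ = from-yes (1 ℕ.≤? 3)
    y≤3 2 _ _ = from-yes (2 ℕ.≤? 3)
    y≤3 3 _ _ = from-yes (3 ℕ.≤? 3)
    y≤3 (suc (suc (suc (suc j)))) {e} (bounds q _ _) lo = ⊥-elim (ℕ.1+n≰n {0} (linear _ _
      (5 ℕ.+ 13 ℕ.* j ℕ.+ 2 ℕ.* (j ℕ.* j)) (ℕ.+-mono-≤ q (ℕ.*-monoʳ-≤ 3 lo)) (identity j e)))
      where
      identity : ∀ j e → let y = 4 ℕ.+ j in
        1 ℕ.+ (3 ℕ.* e ℕ.+ 3 ℕ.* (8 ℕ.+ y)) ℕ.+ (5 ℕ.+ 13 ℕ.* j ℕ.+ 2 ℕ.* (j ℕ.* j))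
          ≡ 0 ℕ.+ (2 ℕ.* (y ℕ.* y) ℕ.+ 1 ℕ.+ 3 ℕ.* (e ℕ.+ 3))
      identity = ℕSolver.solve-∀
    above : Dec (z ≡ 8) → fromℕ b ≤ (fromℕ z - fromℕ y) * fromℕ z + fromℕ e ⊎
                          (z ≡ 8 × b ≡ 52 × fromℕ y ≤ 3 ⁄ 1)
    above (no z≢8) = inj₁ (≤-image ⌜ b ⌝ (difference m y m+y≡z ⊗ ⌜ z ⌝ ⊕ ⌜ e ⌝)
      (generic m m+y≡z L I B z≢8))
    above (yes z≡8) = inj₂ (z≡8 ,
      IsB-unique {z} {b} {52} B (subst (λ z → IsB z 52) {8} {z} (sym z≡8) b8) ,
      ≤-image ⌜ y ⌝ ⌜ 3 ⌝ (y≤3 y I (subst (λ z → e ℕ.+ 3 ℕ.≤ z ℕ.+ y) {z} {8} z≡8 lo)))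

  -- Here x is the approximate root chosen one stage earlier. If z = ζ(w), it is at least w - z/2 -
  -- 3/5, and w ≥ ℓ(z); hence the shift of ℓ(z) in the hypothesis.
  lower-bound : ∀ N {z b x} → 1 ℕ.≤ z → IsB z b → 1ℚ < x → x < tower N →
    fromℕ b - fromℕ z + 3 ⁄ 1 - ½ * fromℕ z - 3 ⁄ 5 ≤ x →
    ∃ λ (q : Fin N → ℚ) → RootsBelow x q × fromℕ z - 11 ⁄ 5 < rWith N q
  lower-bound N {z} {b} {x} 1≤z B 1<x x<tower h = split (z ℕ.≤? 3)
    where
    big : ∀ N → x < tower N → 4 ℕ.≤ z →
      ∃ λ (q : Fin N → ℚ) → RootsBelow x q × fromℕ z - 11 ⁄ 5 < rWith N q
    big zero x<5 4≤z = ⊥-elim (<-irrefl refl (<-≤-trans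
      (threshold-large (fromℕ z) (fromℕ b) (fromℕ-≤ 4 z 4≤z)
        (≤-image (⌜ 2 ⌝ ⊗ (⌜ z ⌝ ⊗ ⌜ z ⌝) ⊕ ⌜ 1 ⌝) (⌜ 3 ⌝ ⊗ ⌜ b ⌝) (Bounds.quadratic (bounds-of 1≤z B))))
      (≤-trans h (<⇒≤ x<5))))
    big (suc M) x<tower 4≤z = cons p q , cons-below 0≤p p²<x q-below ,
      subst (fromℕ z - 11 ⁄ 5 <_) (sym (rWith-cons M p q)) (lower-step (fromℕ z) (fromℕ D.y) _ q-large)
      where
      module D = Descent (descent (ℕ.≤-trans (from-yes (3 ℕ.≤? 4)) 4≤z) B)
      p = fromℕ z - ½ * fromℕ D.y - 3 ⁄ 5
      1<p : 1ℚ < p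
      1<p = 1<lower-root (fromℕ z) (fromℕ D.y) D.gap-y
        (fromℕ-≤ 3 z (ℕ.≤-trans (from-yes (3 ℕ.≤? 4)) 4≤z))
      0≤p : 0ℚ ≤ p
      0≤p = ≤-trans (from-yes (0ℚ ≤? 1ℚ)) (<⇒≤ 1<p)
      p²<x : p * p < x
      p²<x = <-≤-trans (lower-root (fromℕ z) (fromℕ D.y) (fromℕ b) (fromℕ D.e)
        D.level-below D.quadratic D.growth) h
      p<tower : p < tower M
      p<tower = *-cancel-< (0≤tower M) (<-trans p²<x (subst (x <_) (tower-suc M) x<tower))
      rec = lower-bound M D.1≤y D.isB 1<p p<tower
        (lower-threshold (fromℕ z) (fromℕ D.y) (fromℕ D.e) D.lower)
      q = proj₁ rec
      q-below = proj₁ (proj₂ rec)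
      q-large = proj₂ (proj₂ rec)
    split : Dec (z ℕ.≤ 3) → _
    -- All ones suffice up to z = 3, as 3 - 11/5 < 1.
    split (yes z≤3) = (λ _ → 1ℚ) , ones-below N 1<x , subst (fromℕ z - 11 ⁄ 5 <_) (sym (rWith-ones N))
      (≤-<-trans (+-monoˡ-≤ (- (11 ⁄ 5)) (fromℕ-≤ z 3 z≤3)) (from-yes (3 ⁄ 1 - 11 ⁄ 5 <? 1ℚ)))
    split (no z≰3) = big N x<tower (ℕ.≰⇒> z≰3)

  -- The recursion continues at y + 1, not at y = ζ(z), because z is bounded from above by ℓ(y + 1).
  -- Only the largest tower needs to be tracked: taking roots turns the bound by `tower (suc M)`
  -- into the one by `tower M`.
  upper-bound : ∀ N {z b x} → 1 ℕ.≤ z → IsB z b → x < fromℕ b - fromℕ z + 3 ⁄ 1 →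
    (∀ M → N ≡ suc M → tower M ≤ x) →
    ∃ λ (q : Fin N → ℚ) → RootsAbove x q × rWith N q < fromℕ z + 4 ⁄ 5
  upper-bound zero {z} 1≤z B x<ℓ _ = (λ ()) , (λ ()) ,
    <-≤-trans (from-yes (1ℚ <? 1ℚ + 4 ⁄ 5)) (+-monoˡ-≤ (4 ⁄ 5) (fromℕ-≤ 1 z 1≤z))
  upper-bound (suc M) {z} {b} {x} 1≤z B x<ℓ high = cons p q , cons-above 0<p x<p² q-above ,
    subst (_< fromℕ z + 4 ⁄ 5) (sym (rWith-cons M p q)) (upper-step (fromℕ z) (fromℕ D.y) _
      (subst (λ v → rWith M q < v + 4 ⁄ 5) (fromℕ-+ 1 D.y) q-small))
    where
    5≤x : 5 ⁄ 1 ≤ x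
    5≤x = ≤-trans (fromℕ-≤ 5 (5 ℕ.^ (2 ℕ.^ M)) (ℕ.^-monoʳ-≤ 5 (ℕ.m^n>0 2 M))) (high M refl)
    too-small : ∀ c {k} → z ≡ c → IsB c k → fromℕ k - fromℕ c + 3 ⁄ 1 ≤ 5 ⁄ 1 → ⊥
    too-small c refl C small = <-irrefl refl (<-≤-trans x<ℓ (≤-trans
      (≤-reflexive (cong (λ k → fromℕ k - fromℕ z + 3 ⁄ 1) (IsB-unique B C))) (≤-trans small 5≤x)))
    -- 5 ≤ x < ℓ(z), whereas ℓ(1) = 3 and ℓ(2) = 5.
    3≤z : 3 ℕ.≤ z
    3≤z = ℕ.≤∧≢⇒< (ℕ.≤∧≢⇒< 1≤z (λ 1≡z → too-small 1 (sym 1≡z) b1 (from-yes (3 ⁄ 1 ≤? 5 ⁄ 1))))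
                   (λ 2≡z → too-small 2 (sym 2≡z) b2 (from-yes (5 ⁄ 1 ≤? 5 ⁄ 1)))
    module D = Descent (descent 3≤z B)
    p = fromℕ z - ½ * fromℕ D.y + 2 ⁄ 5
    0≤y : 0ℚ ≤ fromℕ D.y
    0≤y = fromℕ-≤ 0 D.y ℕ.z≤n
    0<p : 0ℚ < p
    0<p = 0<upper-root (fromℕ z) (fromℕ D.y) D.gap-y 0≤y
    ℓ<p² : fromℕ b - fromℕ z + 3 ⁄ 1 < p * p
    ℓ<p² = by-cases D.level-above
      where
      by-cases : _ → _
      by-cases (inj₁ h) = upper-root (fromℕ z) (fromℕ D.y) (fromℕ b) (fromℕ D.e) h D.lower D.wide
      by-cases (inj₂ (z≡8 , b≡52 , y≤3)) = subst₂
        (λ b z → fromℕ b - fromℕ z + 3 ⁄ 1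
          < (fromℕ z - ½ * fromℕ D.y + 2 ⁄ 5) * (fromℕ z - ½ * fromℕ D.y + 2 ⁄ 5))
        (sym b≡52) (sym z≡8) (upper-root-8 (fromℕ D.y) y≤3)
    x<p² : x < p * p
    x<p² = <-trans x<ℓ ℓ<p²
    p<ℓ : p < fromℕ D.e′ - fromℕ (suc D.y) + 3 ⁄ 1
    p<ℓ = subst (λ v → p < fromℕ D.e′ - v + 3 ⁄ 1) (sym (fromℕ-+ 1 D.y))
      (upper-threshold (fromℕ z) (fromℕ D.y) (fromℕ D.e′) D.upper 0≤y)
    p-high : ∀ M′ → M ≡ suc M′ → tower M′ ≤ p
    p-high M′ refl = <⇒≤ (*-cancel-< (<⇒≤ 0<p)
      (≤-<-trans (≤-trans (≤-reflexive (sym (tower-suc M′))) (high M refl)) x<p²))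
    rec = upper-bound M (ℕ.s≤s ℕ.z≤n) D.isB′ p<ℓ p-high
    q = proj₁ rec
    q-above = proj₁ (proj₂ rec)
    q-small = proj₂ (proj₂ rec)

  -- The two halves of the estimate

  zeta-values : ∀ {n z} → IsZeta n z → ∃ λ b → ∃ λ b′ → IsB z b × IsB (suc z) b′ ×
    b ℕ.+ 3 ℕ.≤ n ℕ.+ z × suc n ℕ.+ suc z ℕ.≤ b′ ℕ.+ 3
  zeta-values {n} {z} (1≤z , _ , _ , (b , B , refl) , (b′ , B′ , refl) , ℓ≤n , n<ℓ′) =
    b , b′ , B , B′ ,
    ℕ.≤-trans (ℕ.≤-reflexive (rearrange 1≤z B)) (ℕ.+-monoˡ-≤ z ℓ≤n) ,
    ℕ.≤-trans (ℕ.+-monoˡ-≤ (suc z) n<ℓ′) (ℕ.≤-reflexive (sym (rearrange (ℕ.s≤s ℕ.z≤n) B′)))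
    where
    rearrange : ∀ {z b} → 1 ℕ.≤ z → IsB z b → b ℕ.+ 3 ≡ b ℕ.∸ z ℕ.+ 3 ℕ.+ z
    rearrange {z} {b} 1≤z B = trans (cong (ℕ._+ 3) (sym (ℕ.m∸n+n≡m z≤b)))
      (trans (ℕ.+-assoc (b ℕ.∸ z) z 3)
        (trans (cong (b ℕ.∸ z ℕ.+_) (ℕ.+-comm z 3)) (sym (ℕ.+-assoc (b ℕ.∸ z) 3 z))))
      where
      z≤b : z ℕ.≤ b
      z≤b = linear (2 ℕ.* z ℕ.+ 1) (suc b ℕ.+ z) 0
        (ℕ.+-mono-≤ (Bounds.wide (bounds-of 1≤z B)) 1≤z) (identity z b)
        where
        identity : ∀ z b → z ℕ.+ (suc b ℕ.+ z) ℕ.+ 0 ≡ b ℕ.+ (2 ℕ.* z ℕ.+ 1)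
        identity = ℕSolver.solve-∀

  move : ∀ {a b c d} → a + b ≤ c + d → a - d + b ≤ c
  move {a} {b} {c} {d} h = linear≤ (a + b) (c + d) h
    (solve 4 (λ a b c d → a :- d :+ b :+ (c :+ d) := c :+ (a :+ b)) refl a b c d)

  greater : ∀ {n N z b} → 3 ℕ.≤ n → 1 ℕ.≤ z → IsB z b → b ℕ.+ 3 ℕ.≤ n ℕ.+ z →
    n ℕ.< 5 ℕ.^ (2 ℕ.^ N) → RGreater n N (fromℕ z - c1985)
  greater {n} {N} {z} {b} 3≤n 1≤z B ℓ≤n n<tower = split (3 ℕ.≤? z)
    where
    Goal : ℕ → Set
    Goal N = ∃ λ (q : Fin N → ℚ) → RootsBelow (fromℕ n) q × fromℕ z - c1985 < rWith N q
    1<n : 1ℚ < fromℕ n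
    1<n = fromℕ-< 1 n (ℕ.≤-trans (from-yes (2 ℕ.≤? 3)) 3≤n)
    ℓ≤n′ : fromℕ b - fromℕ z + 3 ⁄ 1 ≤ fromℕ n
    ℓ≤n′ = move {fromℕ b} (≤-image (⌜ b ⌝ ⊕ ⌜ 3 ⌝) (⌜ n ⌝ ⊕ ⌜ z ⌝) ℓ≤n)
    big : ∀ N → fromℕ n < tower N → 3 ℕ.≤ z → Goal N
    big zero n<5 3≤z = ⊥-elim (<-irrefl refl (<-≤-trans
      (ell-large (fromℕ z) (fromℕ b) (fromℕ-≤ 3 z 3≤z)
        (≤-image (⌜ 2 ⌝ ⊗ (⌜ z ⌝ ⊗ ⌜ z ⌝) ⊕ ⌜ 1 ⌝) (⌜ 3 ⌝ ⊗ ⌜ b ⌝) (Bounds.quadratic (bounds-of 1≤z B))))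
      (≤-trans ℓ≤n′ (<⇒≤ n<5))))
    big (suc M) n<tower 3≤z = cons p q , cons-below 0≤p p²<n q-below ,
      subst (fromℕ z - c1985 <_) (sym (rWith-cons M p q)) (lower-final (fromℕ z) (fromℕ D.y) _ q-large)
      where
      module D = Descent (descent 3≤z B)
      p = fromℕ z - ½ * fromℕ D.y - 3 ⁄ 10
      p₀<p : fromℕ z - ½ * fromℕ D.y - 3 ⁄ 5 < p
      p₀<p = roots-ordered (fromℕ z) (fromℕ D.y)
      1<p : 1ℚ < p
      1<p = <-trans (1<lower-root (fromℕ z) (fromℕ D.y) D.gap-y (fromℕ-≤ 3 z 3≤z)) p₀<p
      0≤p : 0ℚ ≤ p
      0≤p = ≤-trans (from-yes (0ℚ ≤? 1ℚ)) (<⇒≤ 1<p)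
      p²<n : p * p < fromℕ n
      p²<n = <-≤-trans (first-root (fromℕ z) (fromℕ D.y) (fromℕ b) (fromℕ D.e)
        D.level-below D.quadratic D.growth) ℓ≤n′
      p<tower : p < tower M
      p<tower = *-cancel-< (0≤tower M) (<-trans p²<n (subst (fromℕ n <_) (tower-suc M) n<tower))
      rec = lower-bound M D.1≤y D.isB 1<p p<tower
        (≤-trans (lower-threshold (fromℕ z) (fromℕ D.y) (fromℕ D.e) D.lower) (<⇒≤ p₀<p))
      q = proj₁ rec
      q-below = proj₁ (proj₂ rec)
      q-large = proj₂ (proj₂ rec)
    split : Dec (3 ℕ.≤ z) → Goal N
    split (yes 3≤z) = big N (fromℕ-< n (5 ℕ.^ (2 ℕ.^ N)) n<tower) 3≤z
    -- All ones suffice for z ≤ 2 but not for z = 3, since 3 - 1.985 > 1.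
    split (no z≱3) = (λ _ → 1ℚ) , ones-below N 1<n , subst (fromℕ z - c1985 <_) (sym (rWith-ones N))
      (≤-<-trans (+-monoˡ-≤ (- c1985) (fromℕ-≤ z 2 (ℕ.s≤s⁻¹ (ℕ.≰⇒> z≱3))))
        (from-yes (2 ⁄ 1 - c1985 <? 1ℚ)))

  less : ∀ {n N z b} → IsB (suc z) b → suc n ℕ.+ suc z ℕ.≤ b ℕ.+ 3 →
    (∀ k → k ℕ.< N → 5 ℕ.^ (2 ℕ.^ k) ℕ.≤ n) → RLess n N (fromℕ z + c1985)
  less {n} {N} {z} {b} B n<ℓ high = proj₁ approximation , proj₁ (proj₂ approximation) ,
    upper-final (fromℕ z) _ (subst (λ v → rWith N (proj₁ approximation) < v + 4 ⁄ 5) (fromℕ-+ 1 z)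
      (proj₂ (proj₂ approximation)))
    where
    n<ℓ′ : fromℕ n < fromℕ b - fromℕ (suc z) + 3 ⁄ 1
    n<ℓ′ = linear< (1ℚ + fromℕ n + fromℕ (suc z)) (fromℕ b + 3 ⁄ 1) 1ℚ
      (≤-image (⌜ 1 ⌝ ⊕ ⌜ n ⌝ ⊕ ⌜ suc z ⌝) (⌜ b ⌝ ⊕ ⌜ 3 ⌝) n<ℓ) (positive⁻¹ 1ℚ)
      (solve 3 (λ n z b → n :+ (b :+ con (3 ⁄ 1)) :+ con 1ℚ
          := b :- z :+ con (3 ⁄ 1) :+ (con 1ℚ :+ n :+ z))
        refl (fromℕ n) (fromℕ (suc z)) (fromℕ b))
    towers : ∀ M → N ≡ suc M → tower M ≤ fromℕ n
    towers M N≡ = fromℕ-≤ (5 ℕ.^ (2 ℕ.^ M)) n (high M (ℕ.≤-reflexive (sym N≡)))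
    approximation : ∃ λ (q : Fin N → ℚ) → RootsAbove (fromℕ n) q × rWith N q < fromℕ (suc z) + 4 ⁄ 5
    approximation = upper-bound N (ℕ.s≤s ℕ.z≤n) B n<ℓ′ towers

open import Data.Nat using (ℕ; _≤_)
open import Data.Product using (_×_; _,_)
open import Data.Rational using (_+_; _-_)
open Roots using (zeta-values; greater; less)

theorem4p6 : ∀ (n : ℕ) → 3 ≤ n → ∀ (z : ℕ) → IsZeta n z → ∀ (N : ℕ) → IsN n N →
    RGreater n N (fromℕ z - c1985) × RLess n N (fromℕ z + c1985)
theorem4p6 n 3≤n z Z@(1≤z , _) N (n<tower , high) =
  let _ , _ , B , B′ , ℓ≤n , n<ℓ = zeta-values Z in
  greater 3≤n 1≤z B ℓ≤n n<tower , less B′ n<ℓ high
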